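{- There exist a finite connected graph $G$, a variance-optimal function $X$ over $G$, and sequences $(d_n)_{n\ge1}$ of positive integers and $(r_n)_{n\ge 1}$ of real numbers with $d_n/\sqrt{n}\to\infty$, $d_n/n\to 0$ and $|S_{r_n}|\ge \frac12|V(G^n)|$ for all $n$, where $$S_{r_n}=\Big\{(a_1,\ldots,a_n)\in V(G^n): \sum_{i=1}^n X(a_i)\le r_n\Big\},$$ such that for infinitely many $n$ there is a set $S'\subseteq V(G^n)$ with $|S_{r_n}|\le |S'|$ and $|B_{d_n}(S')|<|B_{d_n}(S_{r_n})|$. That is, the following conjecture of Alon, Boppana and Spencer is not true: if $X$ is variance-optimal over $G$, then for $n$ sufficiently large and $d,r$ in appropriate ranges, $|B_d(S_r)|\le|B_d(S')|$ for all $S'\subset V(G^n)$ with $|S_r|\le|S'|$.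
   Context: A function $X:V(G)\to\mathbb{R}$ is Lipschitz if $|X(u)-X(v)|\le d_G(u,v)$ for all vertices $u,v$, where $d_G$ is the graph distance; it is treated as a random variable by placing the uniform distribution on $V(G)$. It is variance-optimal if it is Lipschitz and has maximum variance among all Lipschitz functions on $V(G)$. $G^n$ is the $n$-fold Cartesian product of $G$: its vertex set is $V(G)^n$ and the distance between $(v_1,\ldots,v_n)$ and $(u_1,\ldots,u_n)$ is $\sum_i d_G(v_i,u_i)$. For a set $S$ of vertices of $G^n$, $B_d(S)=\{u: d_{G^n}(u,S)\le d\}$. -}

module Defs where

open import Data.Fin.Base using (Fin)
open import Data.Fin.Properties using (any?) renaming (_≟_ to _≟ᶠ_)
open import Data.Integer.Base as ℤ using (+_; -[1+_])
import Data.Integer.Properties as ℤₚ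
open import Data.List.Base using (List; length)
open import Data.List.Membership.Propositional using (_∈_)
open import Data.List.Relation.Unary.Unique.Propositional using (Unique)
open import Data.Nat.Base as ℕ using (ℕ; zero; suc)
import Data.Nat.Properties as ℕₚ
open import Data.Nat.Solver using (module +-*-Solver)
open import Data.Product.Base using (∃; ∃-syntax; Σ-syntax; _×_; _,_; proj₁; proj₂)
open import Data.Rational.Base as ℚ using (ℚ; 0ℚ; 1ℚ; ½; mkℚ; toℚᵘ)
import Data.Rational.Properties as ℚₚ
import Data.Rational.Solver as ℚSolver
import Data.Rational.Unnormalised.Base as ℚᵘ
import Data.Rational.Unnormalised.Properties as ℚᵘₚ
open import Data.Sum.Base using (inj₁; inj₂)
open import Data.Vec.Base as Vec using (Vec; foldr′; tabulate; zipWith)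
open import Function.Bundles using (_⇔_)
open import Level using (0ℓ)
open import Relation.Binary.Core using (Rel)
open import Relation.Binary.Definitions using (Symmetric; Irreflexive; Decidable)
open import Relation.Binary.PropositionalEquality
open import Relation.Nullary.Decidable.Core using (Dec; yes; no; _×-dec_; map′)
open import Relation.Nullary.Negation.Core using (¬_; contradiction)
open import Relation.Unary as Unary using (Pred)

------------------------------------------------------------------------
-- Real numbers, as Cauchy sequences of rationals
--
-- Two sequences represent the same real number when each is ≤ᴿ the
-- other; _+ᴿ_, _*ᴿ_, -ᴿ_, ∣_∣ᴿ and _≤ᴿ_ respect this.

IsCauchy : (ℕ → ℚ) → Set
IsCauchy x = ∀ ε → 0ℚ ℚ.< ε → ∃[ N ] ∀ m n → N ℕ.≤ m → N ℕ.≤ n →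
  ℚ.∣ x m ℚ.- x n ∣ ℚ.≤ ε

record ℝ : Set where
  constructor mkℝ
  field
    seq    : ℕ → ℚ
    cauchy : IsCauchy seq

open ℝ public

infix 4 _≤ᴿ_

_≤ᴿ_ : Rel ℝ 0ℓ
x ≤ᴿ y = ∀ ε → 0ℚ ℚ.< ε → ∃[ N ] ∀ n → N ℕ.≤ n → seq x n ℚ.≤ seq y n ℚ.+ ε

private
  ½-pos : ∀ {ε} → 0ℚ ℚ.< ε → 0ℚ ℚ.< ½ ℚ.* ε
  ½-pos {ε} ε>0 = ℚₚ.positive⁻¹ _ {{ℚₚ.pos*pos⇒pos ½ ε {{ℚ.positive ε>0}}}}

  halves : ∀ ε → ½ ℚ.* ε ℚ.+ ½ ℚ.* ε ≡ ε
  halves ε = trans (sym (ℚₚ.*-distribʳ-+ ε ½ ½)) (ℚₚ.*-identityˡ ε)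

  ∣p-p∣≡0 : ∀ p → ℚ.∣ p ℚ.- p ∣ ≡ 0ℚ
  ∣p-p∣≡0 p = cong ℚ.∣_∣ (ℚₚ.+-inverseʳ p)

  ∣-∣-swap : ∀ p q → ℚ.∣ p ℚ.- q ∣ ≡ ℚ.∣ q ℚ.- p ∣
  ∣-∣-swap p q = trans (cong ℚ.∣_∣ lem) (ℚₚ.∣-p∣≡∣p∣ (q ℚ.- p))
    where
    open ℚSolver.+-*-Solver
    lem : p ℚ.- q ≡ ℚ.- (q ℚ.- p)
    lem = solve 2 (λ a b → a :- b := :- (b :- a)) refl p q

  ∣p∣≤∣q∣+∣p-q∣ : ∀ p q → ℚ.∣ p ∣ ℚ.≤ ℚ.∣ q ∣ ℚ.+ ℚ.∣ p ℚ.- q ∣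
  ∣p∣≤∣q∣+∣p-q∣ p q = ℚₚ.≤-trans (ℚₚ.≤-reflexive (cong ℚ.∣_∣ lem))
                        (ℚₚ.∣p+q∣≤∣p∣+∣q∣ q (p ℚ.- q))
    where
    open ℚSolver.+-*-Solver
    lem : p ≡ q ℚ.+ (p ℚ.- q)
    lem = solve 2 (λ a b → a := b :+ (a :- b)) refl p q

  p≤q+r⇒p-q≤r : ∀ p q r → p ℚ.≤ q ℚ.+ r → p ℚ.- q ℚ.≤ r
  p≤q+r⇒p-q≤r p q r h = ℚₚ.≤-trans (ℚₚ.+-monoˡ-≤ (ℚ.- q) h) (ℚₚ.≤-reflexive lem)
    where
    open ℚSolver.+-*-Solver
    lem : (q ℚ.+ r) ℚ.- q ≡ r
    lem = solve 2 (λ a b → (a :+ b) :- a := b) refl q r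

  ∣p-q∣≤ : ∀ p q r → p ℚ.≤ q ℚ.+ r → q ℚ.≤ p ℚ.+ r → ℚ.∣ p ℚ.- q ∣ ℚ.≤ r
  ∣p-q∣≤ p q r h₁ h₂ with ℚₚ.∣p∣≡p∨∣p∣≡-p (p ℚ.- q)
  ... | inj₁ e = subst (ℚ._≤ r) (sym e) (p≤q+r⇒p-q≤r p q r h₁)
  ... | inj₂ e = subst (ℚ._≤ r) (sym (trans e lem)) (p≤q+r⇒p-q≤r q p r h₂)
    where
    open ℚSolver.+-*-Solver
    lem : ℚ.- (p ℚ.- q) ≡ q ℚ.- p
    lem = solve 2 (λ a b → :- (a :- b) := b :- a) refl p q

  ∣∣p∣-∣q∣∣≤∣p-q∣ : ∀ p q → ℚ.∣ ℚ.∣ p ∣ ℚ.- ℚ.∣ q ∣ ∣ ℚ.≤ ℚ.∣ p ℚ.- q ∣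
  ∣∣p∣-∣q∣∣≤∣p-q∣ p q = ∣p-q∣≤ _ _ _ (∣p∣≤∣q∣+∣p-q∣ p q)
    (subst (λ t → ℚ.∣ q ∣ ℚ.≤ ℚ.∣ p ∣ ℚ.+ t) (∣-∣-swap q p) (∣p∣≤∣q∣+∣p-q∣ q p))

  -- A Cauchy sequence is eventually bounded.
  bound : ∀ {x} → IsCauchy x →
    ∃[ B ] 0ℚ ℚ.< B × ∃[ N ] ∀ n → N ℕ.≤ n → ℚ.∣ x n ∣ ℚ.≤ B
  bound {x} cx with cx 1ℚ (ℚₚ.positive⁻¹ 1ℚ)
  ... | N , h = ℚ.∣ x N ∣ ℚ.+ 1ℚ
    , ℚₚ.+-mono-≤-< (ℚₚ.0≤∣p∣ (x N)) (ℚₚ.positive⁻¹ 1ℚ)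
    , N , λ n N≤n → ℚₚ.≤-trans (∣p∣≤∣q∣+∣p-q∣ (x n) (x N))
                      (ℚₚ.+-monoʳ-≤ ℚ.∣ x N ∣ (h n N N≤n ℕₚ.≤-refl))

  -- Given B > 0 and ε > 0, a δ > 0 with B δ = ε.
  scale : ∀ {B ε} → 0ℚ ℚ.< B → 0ℚ ℚ.< ε → ∃[ δ ] 0ℚ ℚ.< δ × B ℚ.* δ ≡ ε
  scale {B} {ε} B>0 ε>0 = 1/B ℚ.* ε
    , ℚₚ.positive⁻¹ _ {{ℚₚ.pos*pos⇒pos 1/B {{ℚₚ.1/pos⇒pos B}} ε {{ℚ.positive ε>0}}}}
    , trans (sym (ℚₚ.*-assoc B 1/B ε))
        (trans (cong (ℚ._* ε) (ℚₚ.*-inverseʳ B)) (ℚₚ.*-identityˡ ε))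
    where
    instance
      _ = ℚ.positive B>0
      _ = ℚₚ.pos⇒nonZero B
    1/B = ℚ.1/ B

  mul-≤ : ∀ {p B q δ} → ℚ.∣ p ∣ ℚ.≤ B → ℚ.∣ q ∣ ℚ.≤ δ → ℚ.∣ p ℚ.* q ∣ ℚ.≤ B ℚ.* δ
  mul-≤ {p} {B} {q} {δ} h₁ h₂ = begin
    ℚ.∣ p ℚ.* q ∣         ≡⟨ ℚₚ.∣p*q∣≡∣p∣*∣q∣ p q ⟩
    ℚ.∣ p ∣ ℚ.* ℚ.∣ q ∣   ≤⟨ ℚₚ.*-monoʳ-≤-nonNeg ℚ.∣ q ∣ {{ℚₚ.∣-∣-nonNeg q}} h₁ ⟩
    B ℚ.* ℚ.∣ q ∣         ≤⟨ ℚₚ.*-monoˡ-≤-nonNeg B {{ℚ.nonNegative B≥0}} h₂ ⟩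
    B ℚ.* δ               ∎
    where
    open ℚₚ.≤-Reasoning
    B≥0 = ℚₚ.≤-trans (ℚₚ.0≤∣p∣ p) h₁

  +-cauchy : ∀ {x y} → IsCauchy x → IsCauchy y → IsCauchy (λ n → x n ℚ.+ y n)
  +-cauchy {x} {y} cx cy ε ε>0 with cx (½ ℚ.* ε) (½-pos ε>0) | cy (½ ℚ.* ε) (½-pos ε>0)
  ... | M , h | N , k = M ℕ.⊔ N , λ m n a b → begin
    ℚ.∣ (x m ℚ.+ y m) ℚ.- (x n ℚ.+ y n) ∣
      ≡⟨ cong ℚ.∣_∣ (lem (x m) (y m) (x n) (y n)) ⟩
    ℚ.∣ (x m ℚ.- x n) ℚ.+ (y m ℚ.- y n) ∣
      ≤⟨ ℚₚ.∣p+q∣≤∣p∣+∣q∣ (x m ℚ.- x n) (y m ℚ.- y n) ⟩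
    ℚ.∣ x m ℚ.- x n ∣ ℚ.+ ℚ.∣ y m ℚ.- y n ∣
      ≤⟨ ℚₚ.+-mono-≤
           (h m n (ℕₚ.m⊔n≤o⇒m≤o M N a) (ℕₚ.m⊔n≤o⇒m≤o M N b))
           (k m n (ℕₚ.m⊔n≤o⇒n≤o M N a) (ℕₚ.m⊔n≤o⇒n≤o M N b)) ⟩
    ½ ℚ.* ε ℚ.+ ½ ℚ.* ε
      ≡⟨ halves ε ⟩
    ε ∎
    where
    open ℚₚ.≤-Reasoning
    open ℚSolver.+-*-Solver using (solve; _:=_; _:+_; _:-_)
    lem : ∀ a b c d → (a ℚ.+ b) ℚ.- (c ℚ.+ d) ≡ (a ℚ.- c) ℚ.+ (b ℚ.- d)
    lem = solve 4 (λ a b c d → (a :+ b) :- (c :+ d) := (a :- c) :+ (b :- d)) refl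

  *-diff : ∀ a b c d {B δ C η} →
    ℚ.∣ a ∣ ℚ.≤ B → ℚ.∣ b ℚ.- d ∣ ℚ.≤ δ → ℚ.∣ d ∣ ℚ.≤ C → ℚ.∣ a ℚ.- c ∣ ℚ.≤ η →
    ℚ.∣ a ℚ.* b ℚ.- c ℚ.* d ∣ ℚ.≤ B ℚ.* δ ℚ.+ C ℚ.* η
  *-diff a b c d h₁ h₂ h₃ h₄ = subst (λ t → ℚ.∣ t ∣ ℚ.≤ _) (sym (lem a b c d))
    (ℚₚ.≤-trans (ℚₚ.∣p+q∣≤∣p∣+∣q∣ (a ℚ.* (b ℚ.- d)) (d ℚ.* (a ℚ.- c)))
                (ℚₚ.+-mono-≤ (mul-≤ {a} {_} {b ℚ.- d} h₁ h₂) (mul-≤ {d} {_} {a ℚ.- c} h₃ h₄)))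
    where
    open ℚSolver.+-*-Solver using (solve; _:=_; _:+_; _:-_; _:*_)
    lem : ∀ a b c d → a ℚ.* b ℚ.- c ℚ.* d ≡ a ℚ.* (b ℚ.- d) ℚ.+ d ℚ.* (a ℚ.- c)
    lem = solve 4 (λ a b c d → a :* b :- c :* d := a :* (b :- d) :+ d :* (a :- c)) refl

  *-cauchy : ∀ {x y} → IsCauchy x → IsCauchy y → IsCauchy (λ n → x n ℚ.* y n)
  *-cauchy {x} {y} cx cy ε ε>0 =
    let B , B>0 , N₁ , hB = bound cx
        C , C>0 , N₂ , hC = bound cy
        δ , δ>0 , Bδ≡ = scale B>0 (½-pos ε>0)
        η , η>0 , Cη≡ = scale C>0 (½-pos ε>0)
        N₃ , h = cy δ δ>0
        N₄ , k = cx η η>0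
        split : ∀ {m} → (N₁ ℕ.⊔ N₂) ℕ.⊔ (N₃ ℕ.⊔ N₄) ℕ.≤ m →
                (N₁ ℕ.≤ m × N₂ ℕ.≤ m) × (N₃ ℕ.≤ m × N₄ ℕ.≤ m)
        split a = ⊔-split N₁ N₂ (proj₁ (⊔-split (N₁ ℕ.⊔ N₂) (N₃ ℕ.⊔ N₄) a))
                , ⊔-split N₃ N₄ (proj₂ (⊔-split (N₁ ℕ.⊔ N₂) (N₃ ℕ.⊔ N₄) a))
    in (N₁ ℕ.⊔ N₂) ℕ.⊔ (N₃ ℕ.⊔ N₄) , λ m n a b →
      let (a₁ , a₂) , (a₃ , a₄) = split a
          (b₁ , b₂) , (b₃ , b₄) = split b
      in subst (ℚ.∣ x m ℚ.* y m ℚ.- x n ℚ.* y n ∣ ℚ.≤_)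
           (trans (cong₂ ℚ._+_ Bδ≡ Cη≡) (halves ε))
           (*-diff (x m) (y m) (x n) (y n) (hB m a₁) (h m n a₃ b₃) (hC n b₂) (k m n a₄ b₄))
    where
    ⊔-split : ∀ p q {m} → p ℕ.⊔ q ℕ.≤ m → p ℕ.≤ m × q ℕ.≤ m
    ⊔-split p q a = ℕₚ.m⊔n≤o⇒m≤o p q a , ℕₚ.m⊔n≤o⇒n≤o p q a

infix  8 -ᴿ_
infixl 7 _*ᴿ_
infixl 6 _+ᴿ_ _-ᴿ_

fromℚ : ℚ → ℝ
fromℚ q = mkℝ (λ _ → q) λ ε ε>0 → 0 , λ _ _ _ _ →
  ℚₚ.≤-trans (ℚₚ.≤-reflexive (∣p-p∣≡0 q)) (ℚₚ.<⇒≤ ε>0)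

fromℕ : ℕ → ℝ
fromℕ n = fromℚ (+ n ℚ./ 1)

_+ᴿ_ : ℝ → ℝ → ℝ
x +ᴿ y = mkℝ (λ n → seq x n ℚ.+ seq y n) (+-cauchy {seq x} {seq y} (cauchy x) (cauchy y))

_*ᴿ_ : ℝ → ℝ → ℝ
x *ᴿ y = mkℝ (λ n → seq x n ℚ.* seq y n) (*-cauchy {seq x} {seq y} (cauchy x) (cauchy y))

-ᴿ_ : ℝ → ℝ
-ᴿ x = mkℝ (λ n → ℚ.- seq x n) λ ε ε>0 →
  proj₁ (cauchy x ε ε>0) , λ m n a b →
  ℚₚ.≤-trans (ℚₚ.≤-reflexive (trans (cong ℚ.∣_∣ (lem (seq x m) (seq x n)))
                                    (ℚₚ.∣-p∣≡∣p∣ (seq x m ℚ.- seq x n))))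
             (proj₂ (cauchy x ε ε>0) m n a b)
  where
  open ℚSolver.+-*-Solver
  lem : ∀ a b → ℚ.- a ℚ.- ℚ.- b ≡ ℚ.- (a ℚ.- b)
  lem = solve 2 (λ a b → :- a :- :- b := :- (a :- b)) refl

_-ᴿ_ : ℝ → ℝ → ℝ
x -ᴿ y = x +ᴿ (-ᴿ y)

∣_∣ᴿ : ℝ → ℝ
∣ x ∣ᴿ = mkℝ (λ n → ℚ.∣ seq x n ∣) λ ε ε>0 →
  proj₁ (cauchy x ε ε>0) , λ m n a b →
  ℚₚ.≤-trans (∣∣p∣-∣q∣∣≤∣p-q∣ (seq x m) (seq x n)) (proj₂ (cauchy x ε ε>0) m n a b)

sumᴿ : ∀ {n} → Vec ℝ n → ℝ
sumᴿ = foldr′ _+ᴿ_ (fromℕ 0)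

------------------------------------------------------------------------
-- Square roots of natural numbers

isqrt : ℕ → ℕ
isqrt zero = zero
isqrt (suc n) with suc (isqrt n) ℕ.* suc (isqrt n) ℕₚ.≤? suc n
... | yes _ = suc (isqrt n)
... | no  _ = isqrt n

isqrt-spec : ∀ n → isqrt n ℕ.* isqrt n ℕ.≤ n × n ℕ.< suc (isqrt n) ℕ.* suc (isqrt n)
isqrt-spec zero = ℕ.z≤n , ℕ.s≤s ℕ.z≤n
isqrt-spec (suc n) with suc (isqrt n) ℕ.* suc (isqrt n) ℕₚ.≤? suc n
... | yes p = p , ℕₚ.≤-<-trans (proj₂ (isqrt-spec n))
                    (ℕₚ.*-mono-< (ℕₚ.n<1+n (suc (isqrt n))) (ℕₚ.n<1+n (suc (isqrt n))))
... | no ¬p = ℕₚ.m≤n⇒m≤1+n (proj₁ (isqrt-spec n)) , ℕₚ.≰⇒> ¬p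

-- ⌊ k √n ⌋ / k with k = suc i, which differs from √n by less than 1 / k
√-approx : ℕ → ℕ → ℚ
√-approx n i = + isqrt (n ℕ.* (suc i ℕ.* suc i)) ℚ./ suc i

private
  /-mono : ∀ a b p q .{{_ : ℕ.NonZero p}} .{{_ : ℕ.NonZero q}} →
    a ℕ.* q ℕ.≤ b ℕ.* p → + a ℚ./ p ℚ.≤ + b ℚ./ q
  /-mono a b p@(suc _) q@(suc _) h = ℚₚ.toℚᵘ-cancel-≤ (begin
    toℚᵘ (+ a ℚ./ p)   ≃⟨ ℚₚ.toℚᵘ-fromℚᵘ (+ a ℚᵘ./ p) ⟩
    + a ℚᵘ./ p         ≤⟨ ℚᵘ.*≤* (subst₂ ℤ._≤_ (ℤₚ.pos-* a q) (ℤₚ.pos-* b p) (ℤ.+≤+ h)) ⟩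
    + b ℚᵘ./ q         ≃⟨ ℚᵘₚ.≃-sym (ℚₚ.toℚᵘ-fromℚᵘ (+ b ℚᵘ./ q)) ⟩
    toℚᵘ (+ b ℚ./ q)   ∎)
    where open ℚᵘₚ.≤-Reasoning

  suc-/ : ∀ b q .{{_ : ℕ.NonZero q}} → + suc b ℚ./ q ≡ + b ℚ./ q ℚ.+ + 1 ℚ./ q
  suc-/ b q@(suc _) = ℚₚ.toℚᵘ-injective (begin
    toℚᵘ (+ suc b ℚ./ q)
      ≈⟨ ℚₚ.toℚᵘ-fromℚᵘ (+ suc b ℚᵘ./ q) ⟩
    + suc b ℚᵘ./ q
      ≈⟨ ℚᵘ.*≡* (trans (sym (ℤₚ.pos-* (suc b) (q ℕ.* q)))
           (trans (cong +_ (lem b q))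
           (trans (ℤₚ.pos-* (b ℕ.* q ℕ.+ 1 ℕ.* q) q)
             (cong (ℤ._* + q) (trans (ℤₚ.pos-+ (b ℕ.* q) (1 ℕ.* q))
               (cong₂ ℤ._+_ (ℤₚ.pos-* b q) (ℤₚ.pos-* 1 q))))))) ⟩
    + b ℚᵘ./ q ℚᵘ.+ + 1 ℚᵘ./ q
      ≈⟨ ℚᵘₚ.+-cong (ℚₚ.toℚᵘ-fromℚᵘ (+ b ℚᵘ./ q)) (ℚₚ.toℚᵘ-fromℚᵘ (+ 1 ℚᵘ./ q)) ⟨
    toℚᵘ (+ b ℚ./ q) ℚᵘ.+ toℚᵘ (+ 1 ℚ./ q)
      ≈⟨ ℚₚ.toℚᵘ-homo-+ (+ b ℚ./ q) (+ 1 ℚ./ q) ⟨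
    toℚᵘ (+ b ℚ./ q ℚ.+ + 1 ℚ./ q) ∎)
    where
    open ℚᵘₚ.≃-Reasoning
    lem : ∀ b q → suc b ℕ.* (q ℕ.* q) ≡ (b ℕ.* q ℕ.+ 1 ℕ.* q) ℕ.* q
    lem = solve 2 (λ b q → (con 1 :+ b) :* (q :* q) := (b :* q :+ con 1 :* q) :* q) refl
      where open +-*-Solver

  1/≤ : ∀ ε → 0ℚ ℚ.< ε → + 1 ℚ./ ℚ.↧ₙ ε ℚ.≤ ε
  1/≤ ε@(mkℚ (+ zero) d c) ε>0 = contradiction (ℚ.positive ε>0) λ ()
  1/≤ ε@(mkℚ -[1+ _ ] d c) ε>0 = contradiction (ℚ.positive ε>0) λ ()
  1/≤ ε@(mkℚ (+ suc a) d c) ε>0 = subst (+ 1 ℚ./ suc d ℚ.≤_) (ℚₚ.↥p/↧p≡p ε)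
    (/-mono 1 (suc a) (suc d) (suc d) (ℕₚ.*-monoˡ-≤ (suc d) {1} {suc a} (ℕ.s≤s ℕ.z≤n)))

  sq-cancel-< : ∀ a b → a ℕ.* a ℕ.< b ℕ.* b → a ℕ.< b
  sq-cancel-< a b h with a ℕₚ.<? b
  ... | yes p = p
  ... | no ¬p = contradiction h
    (ℕₚ.≤⇒≯ (ℕₚ.*-mono-≤ (ℕₚ.≮⇒≥ ¬p) (ℕₚ.≮⇒≥ ¬p)))

  √-close : ∀ n i j → √-approx n i ℚ.≤ √-approx n j ℚ.+ + 1 ℚ./ suc j
  √-close n i j = subst (√-approx n i ℚ.≤_) (suc-/ b q)
    (/-mono a (suc b) p q (ℕₚ.<⇒≤ (sq-cancel-< (a ℕ.* q) (suc b ℕ.* p) (begin-strict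
      (a ℕ.* q) ℕ.* (a ℕ.* q)           ≡⟨ sq a q ⟩
      (a ℕ.* a) ℕ.* (q ℕ.* q)           ≤⟨ ℕₚ.*-monoˡ-≤ (q ℕ.* q)
                                             (proj₁ (isqrt-spec (n ℕ.* (p ℕ.* p)))) ⟩
      n ℕ.* (p ℕ.* p) ℕ.* (q ℕ.* q)     ≡⟨ sw n p q ⟩
      n ℕ.* (q ℕ.* q) ℕ.* (p ℕ.* p)     <⟨ ℕₚ.*-monoˡ-< (p ℕ.* p)
                                             (proj₂ (isqrt-spec (n ℕ.* (q ℕ.* q)))) ⟩
      (suc b ℕ.* suc b) ℕ.* (p ℕ.* p)   ≡⟨ sq (suc b) p ⟨
      (suc b ℕ.* p) ℕ.* (suc b ℕ.* p)   ∎))))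
    where
    open ℕₚ.≤-Reasoning
    open +-*-Solver using (solve; _:=_; _:*_)
    p = suc i
    q = suc j
    a = isqrt (n ℕ.* (p ℕ.* p))
    b = isqrt (n ℕ.* (q ℕ.* q))
    sq : ∀ a q → (a ℕ.* q) ℕ.* (a ℕ.* q) ≡ (a ℕ.* a) ℕ.* (q ℕ.* q)
    sq = solve 2 (λ a q → (a :* q) :* (a :* q) := (a :* a) :* (q :* q)) refl
    sw : ∀ n p q → n ℕ.* (p ℕ.* p) ℕ.* (q ℕ.* q) ≡ n ℕ.* (q ℕ.* q) ℕ.* (p ℕ.* p)
    sw = solve 3 (λ n p q → n :* (p :* p) :* (q :* q) := n :* (q :* q) :* (p :* p)) refl

√_ : ℕ → ℝ
√ n = mkℝ (√-approx n) λ ε ε>0 → ℚ.↧ₙ ε , λ i j a b →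
  ∣p-q∣≤ _ _ ε (close ε ε>0 i j b) (close ε ε>0 j i a)
  where
  close : ∀ ε → 0ℚ ℚ.< ε → ∀ i j → ℚ.↧ₙ ε ℕ.≤ j → √-approx n i ℚ.≤ √-approx n j ℚ.+ ε
  close ε@record{} ε>0 i j h = ℚₚ.≤-trans (√-close n i j) (ℚₚ.+-monoʳ-≤ (√-approx n j)
    (ℚₚ.≤-trans (/-mono 1 1 (suc j) (ℚ.↧ₙ ε) (ℕₚ.*-monoʳ-≤ 1 (ℕₚ.m≤n⇒m≤1+n h)))
                (1/≤ ε ε>0)))

------------------------------------------------------------------------
-- Finite connected simple graphs and their distance

data Walk {k} (_~_ : Rel (Fin k) 0ℓ) : ℕ → Rel (Fin k) 0ℓ where
  here : ∀ {u} → Walk _~_ 0 u u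
  step : ∀ {l u v w} → u ~ v → Walk _~_ l v w → Walk _~_ (suc l) u w

walk? : ∀ {k} {_~_ : Rel (Fin k) 0ℓ} → Decidable _~_ → ∀ l → Decidable (Walk _~_ l)
walk? ~? zero    u w = map′ (λ { refl → here }) (λ { here → refl }) (u ≟ᶠ w)
walk? ~? (suc l) u w =
  map′ (λ (_ , e , p) → step e p) (λ { (step e p) → _ , e , p })
       (any? λ v → ~? u v ×-dec walk? ~? l v w)

least : ∀ {P : Pred ℕ 0ℓ} → Unary.Decidable P → ∀ b → P b →
        ∃[ m ] P m × (∀ n → P n → m ℕ.≤ n)
least P? b pb with P? 0
... | yes p0 = 0 , p0 , λ _ _ → ℕ.z≤n
least P? zero    pb | no ¬p0 = contradiction pb ¬p0
least P? (suc b) pb | no ¬p0 with least (λ n → P? (suc n)) b pb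
... | m , pm , min = suc m , pm , λ where
  zero    p0 → contradiction p0 ¬p0
  (suc n) pn → ℕ.s≤s (min n pn)

-- Adjacency is required to be decidable, which classically is no
-- restriction and makes the least length of a walk computable.
record ConnectedGraph : Set₁ where
  field
    order         : ℕ
    {{nonEmpty}}  : ℕ.NonZero order

  Vertex : Set
  Vertex = Fin order

  field
    _~_           : Rel Vertex 0ℓ
    ~-sym         : Symmetric _~_
    ~-irrefl      : Irreflexive _≡_ _~_
    ~-dec         : Decidable _~_
    connected     : ∀ u v → ∃[ l ] Walk _~_ l u v

  private
    shortest : ∀ u v → ∃[ m ] Walk _~_ m u v × (∀ l → Walk _~_ l u v → m ℕ.≤ l)
    shortest u v = least (λ l → walk? ~-dec l u v)
                         (proj₁ (connected u v)) (proj₂ (connected u v))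

  dist : Vertex → Vertex → ℕ
  dist u v = proj₁ (shortest u v)

  dist-walk : ∀ u v → Walk _~_ (dist u v) u v
  dist-walk u v = proj₁ (proj₂ (shortest u v))

  dist-min : ∀ u v l → Walk _~_ l u v → dist u v ℕ.≤ l
  dist-min u v = proj₂ (proj₂ (shortest u v))

open ConnectedGraph public using (order; Vertex; dist)

------------------------------------------------------------------------
-- Lipschitz functions and their variance under the uniform distribution

module _ (G : ConnectedGraph) where
  open ConnectedGraph G using (nonEmpty)

  IsLipschitz : (Vertex G → ℝ) → Set
  IsLipschitz X = ∀ u v → ∣ X u -ᴿ X v ∣ᴿ ≤ᴿ fromℕ (dist G u v)

  𝔼 : (Vertex G → ℝ) → ℝ
  𝔼 X = fromℚ (+ 1 ℚ./ order G) *ᴿ sumᴿ (tabulate X)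

  Var : (Vertex G → ℝ) → ℝ
  Var X = 𝔼 λ v → (X v -ᴿ 𝔼 X) *ᴿ (X v -ᴿ 𝔼 X)

  IsVarianceOptimal : (Vertex G → ℝ) → Set
  IsVarianceOptimal X = IsLipschitz X × (∀ Y → IsLipschitz Y → Var Y ≤ᴿ Var X)

------------------------------------------------------------------------
-- The Cartesian power Gⁿ

  Vertexⁿ : ℕ → Set
  Vertexⁿ n = Vec (Vertex G) n

  distⁿ : ∀ {n} → Vertexⁿ n → Vertexⁿ n → ℕ
  distⁿ u v = Vec.sum (zipWith (dist G) u v)

  Ball : ∀ {n} → ℕ → Pred (Vertexⁿ n) 0ℓ → Pred (Vertexⁿ n) 0ℓ
  Ball d S u = ∃[ v ] S v × distⁿ u v ℕ.≤ d

  Sublevel : (Vertex G → ℝ) → ∀ n → ℝ → Pred (Vertexⁿ n) 0ℓ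
  Sublevel X n r a = sumᴿ (Vec.map X a) ≤ᴿ r

------------------------------------------------------------------------
-- Cardinalities of subsets
--
-- The order on ℝ is not decidable, so a subset need not come with a
-- cardinality; it has one when its elements can be listed.

HasCard : {A : Set} → Pred A 0ℓ → ℕ → Set
HasCard {A} P m =
  Σ[ xs ∈ List A ] Unique xs × (∀ a → a ∈ xs ⇔ P a) × length xs ≡ m

infix 4 _≤ᶜ_ _<ᶜ_

_≤ᶜ_ : {A : Set} → Rel (Pred A 0ℓ) 0ℓ
P ≤ᶜ Q = ∃[ p ] ∃[ q ] HasCard P p × HasCard Q q × p ℕ.≤ q

_<ᶜ_ : {A : Set} → Rel (Pred A 0ℓ) 0ℓ
P <ᶜ Q = ∃[ p ] ∃[ q ] HasCard P p × HasCard Q q × p ℕ.< q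

AtLeastHalf : {A : Set} → Pred A 0ℓ → Set
AtLeastHalf {A} P =
  ∃[ t ] ∃[ p ] HasCard {A} Unary.U t × HasCard P p × t ℕ.≤ 2 ℕ.* p

------------------------------------------------------------------------
-- Growth conditions

-- d n / √ n → ∞, with M ≤ d n / √ n written as M * √ n ≤ d n
_/√n→∞ : (ℕ → ℕ) → Set
d /√n→∞ = ∀ (M : ℚ) → ∃[ N ] ∀ n → N ℕ.≤ n → 1 ℕ.≤ n →
  fromℚ M *ᴿ √ n ≤ᴿ fromℕ (d n)

_/n→0 : (ℕ → ℕ) → Set
d /n→0 = ∀ (ε : ℚ) → 0ℚ ℚ.< ε → ∃[ N ] ∀ n → .{{_ : ℕ.NonZero n}} → N ℕ.≤ n →
  + d n ℚ./ n ℚ.< ε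

{-# OPTIONS --safe #-}

-- Near the maximum of Σ X(aᵢ) the isoperimetric problem is about small sets: S fails to be extremal as
-- soon as some set A′ of two or more points has a smaller d-neighbourhood than the complement of S, while only one
-- point lies at distance more than d from S.  Take G to be layered 0 | 1 2 3 | 4 | 5 with consecutive
-- layers completely joined, and X = -level, whose unique maximum 0 has degree 3, whereas 5 has degree 1.
-- For S = {Σ level ≥ d + 1} the complement is the d-ball around 0ⁿ, of size at least 3ᵈ (n C d), and
-- B_d(S) misses only 0ⁿ.  Let S′ be the complement of the d-ball around {0, …, 5} × {5ⁿ⁻¹}, a set of size
-- at most 6 · 2 (5/2)ᵈ (n-1 C d), which is smaller; but B_d(S′) misses at least the six points of
-- {0, …, 5} × {5ⁿ⁻¹}.
-- Here d = ⌊√n⌋ ⌊√⌊√n⌋⌋.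

module Submission where

open import Defs
open import Algebra.Properties.Group using (⁻¹-involutive)
open import Data.Bool.Base using (true; false; if_then_else_)
open import Data.Fin.Base using (Fin; toℕ) renaming (suc to fsuc)
open import Data.Fin.Patterns
open import Data.Integer.Base as ℤ using (+_; -[1+_])
import Data.Integer.Properties as ℤₚ
open import Data.List.Base
  using (List; []; _∷_; filter; map; _++_; length; allFin; cartesianProductWith)
open import Data.List.Membership.Propositional using (_∈_; find; lose)
open import Data.List.Membership.Propositional.Properties
  using (∈-filter⁺; ∈-filter⁻; ∈-allFin; ∈-cartesianProductWith⁺)
open import Data.List.Properties
  using (filter-++; filter-≐; filter-accept; filter-none; length-++; length-filter; length-map; length-tabulate; map-cong)
open import Data.List.Relation.Binary.Sublist.Propositional using (⊆-refl)
import Data.List.Relation.Binary.Sublist.Propositional.Properties as Sublist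
open import Data.List.Relation.Unary.All as All using ([])
open import Data.List.Relation.Unary.AllPairs using ([]; _∷_)
open import Data.List.Relation.Unary.Any as Any using (here)
open import Data.List.Relation.Unary.Unique.Propositional using (Unique)
import Data.List.Relation.Unary.Unique.Propositional.Properties as Unique
open import Data.Nat.Base
open import Data.Nat.Combinatorics
  using (k>n⇒nCk≡0; nC1≡n; nCn≡1; nCk≡nC[n∸k]; nCk+nC[k+1]≡[n+1]C[k+1])
  renaming (_C_ to infixl 7.5 _C_)
import Data.Nat.ListAction as List
open import Data.Nat.Properties
open import Algebra.Properties.CommutativeSemigroup +-commutativeSemigroup using (x∙yz≈yx∙z)
open import Data.Nat.Solver using (module +-*-Solver)
open import Data.Product.Base using (Σ-syntax; ∃-syntax; _×_; _,_; proj₁; proj₂)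
open import Data.Rational.Base as ℚ using (ℚ; 0ℚ; 1ℚ; mkℚ; toℚᵘ)
import Data.Rational.Properties as ℚₚ
import Data.Rational.Solver as ℚSolver
import Data.Rational.Unnormalised.Base as ℚᵘ
import Data.Rational.Unnormalised.Properties as ℚᵘₚ
open import Data.Sum.Base using (_⊎_; inj₁; inj₂; [_,_]′)
open import Data.Vec.Base as Vec using (Vec; []; _∷_; sum)
open import Data.Vec.Properties using (∷-injective)
open import Function.Base using (_∘_)
open import Function.Bundles using (mk⇔)
open import Level using (0ℓ)
open import Relation.Binary.PropositionalEquality
open import Relation.Nullary.Decidable using (does; yes; no; map′; _×-dec_; dec-true; dec-false)
open import Relation.Nullary.Negation using (contradiction)
open import Relation.Unary using (Pred; Decidable; ∁; _⊆_; U; _≐_)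
open import Relation.Unary.Properties using (∁?)

open +-*-Solver using (solve; con; _:+_; _:*_; _:=_)

-- Rational numbers and square roots

/-mono-≤ : ∀ a b p q .{{_ : NonZero p}} .{{_ : NonZero q}} →
  a * q ≤ b * p → + a ℚ./ p ℚ.≤ + b ℚ./ q
/-mono-≤ a b p@(suc _) q@(suc _) h = ℚₚ.toℚᵘ-cancel-≤ (begin
  toℚᵘ (+ a ℚ./ p)   ≃⟨ ℚₚ.toℚᵘ-fromℚᵘ (+ a ℚᵘ./ p) ⟩
  + a ℚᵘ./ p         ≤⟨ ℚᵘ.*≤* (subst₂ ℤ._≤_ (ℤₚ.pos-* a q) (ℤₚ.pos-* b p) (ℤ.+≤+ h)) ⟩
  + b ℚᵘ./ q         ≃⟨ ℚᵘₚ.≃-sym (ℚₚ.toℚᵘ-fromℚᵘ (+ b ℚᵘ./ q)) ⟩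
  toℚᵘ (+ b ℚ./ q)   ∎)
  where open ℚᵘₚ.≤-Reasoning

/-mono-< : ∀ a b p q .{{_ : NonZero p}} .{{_ : NonZero q}} →
  a * q < b * p → + a ℚ./ p ℚ.< + b ℚ./ q
/-mono-< a b p@(suc _) q@(suc _) h = ℚₚ.toℚᵘ-cancel-< (begin-strict
  toℚᵘ (+ a ℚ./ p)   ≃⟨ ℚₚ.toℚᵘ-fromℚᵘ (+ a ℚᵘ./ p) ⟩
  + a ℚᵘ./ p         <⟨ ℚᵘ.*<* (subst₂ ℤ._<_ (ℤₚ.pos-* a q) (ℤₚ.pos-* b p) (ℤ.+<+ h)) ⟩
  + b ℚᵘ./ q         ≃⟨ ℚᵘₚ.≃-sym (ℚₚ.toℚᵘ-fromℚᵘ (+ b ℚᵘ./ q)) ⟩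
  toℚᵘ (+ b ℚ./ q)   ∎)
  where open ℚᵘₚ.≤-Reasoning

/1-cancel-≤ : ∀ a b → + a ℚ./ 1 ℚ.≤ + b ℚ./ 1 → a ≤ b
/1-cancel-≤ a b h = ≮⇒≥ λ b<a →
  ℚₚ.<-irrefl refl (ℚₚ.<-≤-trans (/-mono-< b a 1 1 (*-monoˡ-< 1 b<a)) h)

/1-+ : ∀ a b → + (a + b) ℚ./ 1 ≡ + a ℚ./ 1 ℚ.+ + b ℚ./ 1
/1-+ a b = ℚₚ.toℚᵘ-injective (begin
  toℚᵘ (+ (a + b) ℚ./ 1)                      ≈⟨ ℚₚ.toℚᵘ-fromℚᵘ (+ (a + b) ℚᵘ./ 1) ⟩
  + (a + b) ℚᵘ./ 1                            ≈⟨ ℚᵘ.*≡* (cong (ℤ._* + 1) (cong₂ ℤ._+_ (sym (ℤₚ.*-identityʳ (+ a))) (sym (ℤₚ.*-identityʳ (+ b))))) ⟩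
  + a ℚᵘ./ 1 ℚᵘ.+ + b ℚᵘ./ 1                  ≈⟨ ℚᵘₚ.+-cong (ℚₚ.toℚᵘ-fromℚᵘ (+ a ℚᵘ./ 1)) (ℚₚ.toℚᵘ-fromℚᵘ (+ b ℚᵘ./ 1)) ⟨
  toℚᵘ (+ a ℚ./ 1) ℚᵘ.+ toℚᵘ (+ b ℚ./ 1)      ≈⟨ ℚₚ.toℚᵘ-homo-+ (+ a ℚ./ 1) (+ b ℚ./ 1) ⟨
  toℚᵘ (+ a ℚ./ 1 ℚ.+ + b ℚ./ 1)              ∎)
  where open ℚᵘₚ.≃-Reasoning

/1-*-/ : ∀ k a q .{{_ : NonZero q}} → + k ℚ./ 1 ℚ.* (+ a ℚ./ q) ≡ + (k * a) ℚ./ q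
/1-*-/ k a q@(suc _) = ℚₚ.toℚᵘ-injective (begin
  toℚᵘ (+ k ℚ./ 1 ℚ.* (+ a ℚ./ q))            ≈⟨ ℚₚ.toℚᵘ-homo-* (+ k ℚ./ 1) (+ a ℚ./ q) ⟩
  toℚᵘ (+ k ℚ./ 1) ℚᵘ.* toℚᵘ (+ a ℚ./ q)      ≈⟨ ℚᵘₚ.*-cong (ℚₚ.toℚᵘ-fromℚᵘ (+ k ℚᵘ./ 1)) (ℚₚ.toℚᵘ-fromℚᵘ (+ a ℚᵘ./ q)) ⟩
  (+ k ℚᵘ./ 1) ℚᵘ.* (+ a ℚᵘ./ q)              ≈⟨ ℚᵘ.*≡* (cong₂ ℤ._*_ (sym (ℤₚ.pos-* k a)) (cong +_ (sym (*-identityˡ q)))) ⟩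
  + (k * a) ℚᵘ./ q                            ≈⟨ ℚₚ.toℚᵘ-fromℚᵘ (+ (k * a) ℚᵘ./ q) ⟨
  toℚᵘ (+ (k * a) ℚ./ q)                      ∎)
  where open ℚᵘₚ.≃-Reasoning

-- If q < p, pick m strictly between them by density; ε = m - q then gives p ≤ m. This recovers an
-- exact inequality from `_≤ᴿ_` between constant sequences.
≤-archimedean : ∀ p q → (∀ ε → 0ℚ ℚ.< ε → p ℚ.≤ q ℚ.+ ε) → p ℚ.≤ q
≤-archimedean p q h = ℚₚ.≮⇒≥ λ q<p →
  let m , q<m , m<p = ℚₚ.<-dense q<p in
  ℚₚ.<-irrefl refl (ℚₚ.<-≤-trans m<p (subst (p ℚ.≤_) (q+[m-q] m) (h (m ℚ.- q) (0<m-q m q<m))))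
  where
  q+[m-q] : ∀ m → q ℚ.+ (m ℚ.- q) ≡ m
  q+[m-q] m = trans (sym (ℚₚ.+-assoc q m (ℚ.- q))) (trans (cong (ℚ._- q) (ℚₚ.+-comm q m))
    (trans (ℚₚ.+-assoc m q (ℚ.- q)) (trans (cong (m ℚ.+_) (ℚₚ.+-inverseʳ q)) (ℚₚ.+-identityʳ m))))
  0<m-q : ∀ m → q ℚ.< m → 0ℚ ℚ.< m ℚ.- q
  0<m-q m q<m = subst (ℚ._< m ℚ.- q) (ℚₚ.+-inverseʳ q) (ℚₚ.+-monoˡ-< (ℚ.- q) q<m)

≤+ε : ∀ {p q ε} → p ℚ.≤ q → 0ℚ ℚ.< ε → p ℚ.≤ q ℚ.+ ε
≤+ε {p} {q} {ε} p≤q ε>0 = subst (ℚ._≤ q ℚ.+ ε) (ℚₚ.+-identityʳ p) (ℚₚ.+-mono-≤ p≤q (ℚₚ.<⇒≤ ε>0))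

-- Integer roots and the growth of the radius

isqrt-≥ : ∀ {m n} → m * m ≤ n → m ≤ isqrt n
isqrt-≥ {m} {n} h = ≮⇒≥ λ r<m → <⇒≱ (<-≤-trans (proj₂ (isqrt-spec n)) (*-mono-≤ r<m r<m)) h

root₄ : ℕ → ℕ
root₄ n = isqrt (isqrt n)

root₄-≥ : ∀ m {n} → (m * m) * (m * m) ≤ n → m ≤ root₄ n
root₄-≥ m h = isqrt-≥ (isqrt-≥ h)

-- Of order n^(3/4): both d / √n and n / d are controlled from below by `root₄ n`, which is
-- unbounded.
radius : ℕ → ℕ
radius n = isqrt n * root₄ n

radius*root₄≤n : ∀ n → radius n * root₄ n ≤ n
radius*root₄≤n n = begin
  s * t * t      ≡⟨ *-assoc s t t ⟩
  s * (t * t)    ≤⟨ *-monoʳ-≤ s (proj₁ (isqrt-spec s)) ⟩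
  s * s          ≤⟨ proj₁ (isqrt-spec n) ⟩
  n              ∎
  where
  open ≤-Reasoning
  s = isqrt n
  t = root₄ n

root₄≤radius : ∀ n → root₄ n ≤ radius n
root₄≤radius n with isqrt n
... | zero  = z≤n
... | suc s = m≤m+n (isqrt (suc s)) (s * isqrt (suc s))

1≤radius : ∀ n → 1 ≤ n → 1 ≤ radius n
1≤radius n h = ≤-trans (root₄-≥ 1 h) (root₄≤radius n)

-- Bounds every rational approximation ⌊k √n⌋ / k of √n by ⌊√n⌋ + 1, uniformly in k.
isqrt-scale : ∀ n k → isqrt (n * (k * k)) ≤ suc (isqrt n) * k
isqrt-scale n k = ≮⇒≥ λ h → <⇒≱ (*-mono-< h h) (begin
  r * r                             ≤⟨ proj₁ (isqrt-spec (n * (k * k))) ⟩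
  n * (k * k)                       ≤⟨ *-monoˡ-≤ (k * k) (<⇒≤ (proj₂ (isqrt-spec n))) ⟩
  suc s * suc s * (k * k)           ≡⟨ solve 2 (λ a k → a :* a :* (k :* k) := a :* k :* (a :* k)) refl (suc s) k ⟩
  suc s * k * (suc s * k)           ∎)
  where
  open ≤-Reasoning
  s = isqrt n
  r = isqrt (n * (k * k))

≤-nat : ∀ M → ∃[ K ] M ℚ.≤ + K ℚ./ 1
≤-nat M@(mkℚ (+ a) b c) = a , subst (ℚ._≤ + a ℚ./ 1) (ℚₚ.↥p/↧p≡p M) (/-mono-≤ a a (suc b) 1 (*-monoʳ-≤ a (s≤s z≤n)))
≤-nat M@(mkℚ -[1+ a ] b c) = 0 , ℚₚ.<⇒≤ (ℚₚ.negative⁻¹ M)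

radius-bound : ∀ K n k → K * 2 ≤ root₄ n → 1 ≤ n → K * isqrt (n * (k * k)) * 1 ≤ radius n * k
radius-bound K n k K≤ n≥1 = begin
  K * isqrt (n * (k * k)) * 1      ≡⟨ *-identityʳ _ ⟩
  K * isqrt (n * (k * k))          ≤⟨ *-monoʳ-≤ K (isqrt-scale n k) ⟩
  -- Since n ≥ 1, s ≥ 1, so 1 + s is at most 2s; this is the factor 2 in the hypothesis on
  -- `root₄ n`.
  K * ((1 + s) * k)                ≤⟨ *-monoʳ-≤ K (*-monoˡ-≤ k (+-monoˡ-≤ s (isqrt-≥ {1} n≥1))) ⟩
  K * ((s + s) * k)                ≡⟨ solve 3 (λ K s k → K :* ((s :+ s) :* k) := s :* (K :* con 2) :* k) refl K s k ⟩
  s * (K * 2) * k                  ≤⟨ *-monoˡ-≤ k (*-monoʳ-≤ s K≤) ⟩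
  radius n * k                          ∎
  where
  s = isqrt n
  open ≤-Reasoning

radius-superroot : radius /√n→∞
radius-superroot M with ≤-nat M
-- From (2K)⁴ on, `root₄ n` is at least 2K. The inequality then holds at every index i of the
-- approximation of √n, hence the inner bound 0.
... | K , M≤K = (K * 2) * (K * 2) * ((K * 2) * (K * 2)) , λ n N≤n n≥1 ε ε>0 → 0 , λ i _ → ≤+ε (begin
  M ℚ.* √-approx n i                              ≤⟨ ℚₚ.*-monoʳ-≤-nonNeg (√-approx n i) {{√≥0 n i}} M≤K ⟩
  + K ℚ./ 1 ℚ.* √-approx n i                      ≡⟨ /1-*-/ K (isqrt (n * (suc i * suc i))) (suc i) ⟩
  + (K * isqrt (n * (suc i * suc i))) ℚ./ suc i   ≤⟨ /-mono-≤ (K * isqrt (n * (suc i * suc i))) (radius n) (suc i) 1 (radius-bound K n (suc i) (root₄-≥ (K * 2) N≤n) n≥1) ⟩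
  + radius n ℚ./ 1                                     ∎) ε>0
  where
  open ℚₚ.≤-Reasoning
  √≥0 : ∀ n i → ℚ.NonNegative (√-approx n i)
  √≥0 n i = ℚₚ.normalize-nonNeg (isqrt (n * (suc i * suc i))) (suc i)

radius-sublinear : radius /n→0
radius-sublinear ε@(mkℚ (+ zero) _ _) ε>0 = contradiction (ℚ.positive ε>0) λ ()
radius-sublinear ε@(mkℚ -[1+ _ ] _ _) ε>0 = contradiction (ℚ.positive ε>0) λ ()
-- Here ε = (a + 1) / (b + 1). Asking for `root₄ n` ≥ b + 2 rather than b + 1 makes the inequality
-- strict, as d ≥ 1.
radius-sublinear ε@(mkℚ (+ suc a) b _) ε>0 = (2 + b) * (2 + b) * ((2 + b) * (2 + b)) , λ n N≤n →
  subst (+ radius n ℚ./ n ℚ.<_) (ℚₚ.↥p/↧p≡p ε) (/-mono-< (radius n) (suc a) n (suc b) (lt n N≤n))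
  where
  open ≤-Reasoning
  lt : ∀ n .{{_ : NonZero n}} → (2 + b) * (2 + b) * ((2 + b) * (2 + b)) ≤ n → radius n * suc b < suc a * n
  lt n@(suc _) N≤n = begin-strict
    radius n * suc b        <⟨ *-monoʳ-< (radius n) {{>-nonZero (1≤radius n (s≤s z≤n))}} (n<1+n (suc b)) ⟩
    radius n * (2 + b)      ≤⟨ *-monoʳ-≤ (radius n) (root₄-≥ (2 + b) N≤n) ⟩
    radius n * root₄ n         ≤⟨ radius*root₄≤n n ⟩
    n                  ≤⟨ m≤n*m n (suc a) ⟩
    suc a * n          ∎

-- Counting words by weight

words : ∀ k n → List (Vec (Fin k) n)
words k zero    = [] ∷ []
words k (suc n) = cartesianProductWith _∷_ (allFin k) (words k n)

words-complete : ∀ {k n} (s : Vec (Fin k) n) → s ∈ words k n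
words-complete []      = here refl
words-complete (x ∷ s) = ∈-cartesianProductWith⁺ _∷_ (∈-allFin x) (words-complete s)

words-unique : ∀ k n → Unique (words k n)
words-unique k zero    = [] ∷ []
words-unique k (suc n) =
  Unique.cartesianProductWith⁺ _∷_ ∷-injective (Unique.allFin⁺ k) (words-unique k n)

card : ∀ {k n} {P : Pred (Vec (Fin k) n) 0ℓ} → Decidable P → ℕ
card {k} {n} P? = length (filter P? (words k n))

hasCard : ∀ {k n} {P : Pred (Vec (Fin k) n) 0ℓ} (P? : Decidable P) → HasCard P (card P?)
hasCard {k} {n} P? =
  filter P? (words k n) , Unique.filter⁺ P? (words-unique k n) ,
  (λ a → mk⇔ (λ h → proj₂ (∈-filter⁻ P? {xs = words k n} h)) (∈-filter⁺ P? (words-complete a))) , refl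

card-mono : ∀ {k n} {P Q : Pred (Vec (Fin k) n) 0ℓ} (P? : Decidable P) (Q? : Decidable Q) →
  P ⊆ Q → card P? ≤ card Q?
card-mono P? Q? P⊆Q = Sublist.length-mono-≤ (Sublist.filter⁺ P? Q? (λ { refl → P⊆Q }) (⊆-refl {x = words _ _}))

length-filter-∁ : ∀ {A : Set} {P : Pred A 0ℓ} (P? : Decidable P) xs →
  length (filter P? xs) + length (filter (∁? P?) xs) ≡ length xs
length-filter-∁ P? []       = refl
length-filter-∁ P? (x ∷ xs) with P? x
... | yes _ = cong suc (length-filter-∁ P? xs)
... | no  _ = trans (+-suc _ _) (cong suc (length-filter-∁ P? xs))

card-∁ : ∀ {k n} {P : Pred (Vec (Fin k) n) 0ℓ} (P? : Decidable P) →
  card P? + card (∁? P?) ≡ length (words k n)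
card-∁ {k} {n} P? = length-filter-∁ P? (words k n)

length-filter-map : ∀ {A B : Set} {P : Pred B 0ℓ} (P? : Decidable P) (f : A → B) xs →
  length (filter P? (map f xs)) ≡ length (filter (P? ∘ f) xs)
length-filter-map P? f []       = refl
length-filter-map P? f (x ∷ xs) with does (P? (f x))
... | true  = cong suc (length-filter-map P? f xs)
... | false = length-filter-map P? f xs

length-filter-cartesian : ∀ {A B D : Set} {P : Pred D 0ℓ} (P? : Decidable P) (f : A → B → D) xs ys →
  length (filter P? (cartesianProductWith f xs ys)) ≡ List.sum (map (λ x → length (filter (P? ∘ f x) ys)) xs)
length-filter-cartesian P? f []       ys = refl
length-filter-cartesian P? f (x ∷ xs) ys = begin
  length (filter P? (map (f x) ys ++ rest))                       ≡⟨ cong length (filter-++ P? (map (f x) ys) rest) ⟩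
  length (filter P? (map (f x) ys) ++ filter P? rest)             ≡⟨ length-++ (filter P? (map (f x) ys)) ⟩
  length (filter P? (map (f x) ys)) + length (filter P? rest)     ≡⟨ cong₂ _+_ (length-filter-map P? (f x) ys) (length-filter-cartesian P? f xs ys) ⟩
  _                                                               ∎
  where
  open ≡-Reasoning
  rest = cartesianProductWith f xs ys

card-suc : ∀ {k n} {P : Pred (Vec (Fin k) (suc n)) 0ℓ} (P? : Decidable P) →
  card P? ≡ List.sum (map (λ x → card (P? ∘ (x ∷_))) (allFin k))
card-suc {k} {n} P? = length-filter-cartesian P? _∷_ (allFin k) (words k n)

length-cartesian : ∀ {A B D : Set} (f : A → B → D) xs ys →
  length (cartesianProductWith f xs ys) ≡ length xs * length ys
length-cartesian f []       ys = refl
length-cartesian f (x ∷ xs) ys = trans (length-++ (map (f x) ys))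
  (cong₂ _+_ (length-map (f x) ys) (length-cartesian f xs ys))

length-words : ∀ k n → length (words k n) ≡ k ^ n
length-words k zero    = refl
length-words k (suc n) = trans (length-cartesian _∷_ (allFin k) (words k n))
  (cong₂ _*_ (length-tabulate {n = k} (λ x → x)) (length-words k n))

-- The head is unconstrained, so `card-suc` gives six equal summands, and their sum computes to the
-- product.
card-∷ : ∀ {n} {P : Pred (Vec (Fin 6) n) 0ℓ} (P? : Decidable P) →
  card (λ (s : Vec (Fin 6) (suc n)) → P? (Vec.tail s)) ≡ 6 * card P?
card-∷ {n} P? = card-suc {6} {n} (λ s → P? (Vec.tail s))

-- A set and its complement together exhaust the words. Large sets are compared in this way through
-- their small complements.
card-∁-anti-≤ : ∀ {k n} {P Q : Pred (Vec (Fin k) n) 0ℓ} (P? : Decidable P) (Q? : Decidable Q) →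
  card (∁? P?) ≤ card (∁? Q?) → card Q? ≤ card P?
card-∁-anti-≤ P? Q? h = +-cancelʳ-≤ (card (∁? P?)) _ _ (≤-trans (+-monoʳ-≤ (card Q?) h)
  (≤-reflexive (trans (card-∁ Q?) (sym (card-∁ P?)))))

card-∁-anti-< : ∀ {k n} {P Q : Pred (Vec (Fin k) n) 0ℓ} (P? : Decidable P) (Q? : Decidable Q) →
  card (∁? P?) < card (∁? Q?) → card Q? < card P?
card-∁-anti-< P? Q? h = +-cancelʳ-< (card (∁? P?)) _ _ (<-≤-trans (+-monoʳ-< (card Q?) h)
  (≤-reflexive (trans (card-∁ Q?) (sym (card-∁ P?)))))

module _ {k} (ω : Fin k → ℕ) where
  weight : ∀ {n} → Vec (Fin k) n → ℕ
  weight s = sum (Vec.map ω s)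

  -- Keeping the offset i separate from d spares the recursion in n a truncated subtraction d ∸ ω x.
  #≤ : ∀ n (i d : ℕ) → ℕ
  #≤ n i d = card {k} {n} (λ s → i + weight s ≤? d)

  -- Conditioning on the first letter moves its weight into the offset.
  #≤-suc : ∀ n i d → #≤ (suc n) i d ≡ List.sum (map (λ x → #≤ n (ω x + i) d) (allFin k))
  #≤-suc n i d = trans (card-suc {k} {n} (λ s → i + weight s ≤? d))
    (cong List.sum (map-cong (λ x → cong length (filter-≐ _ _ (move x) (words k n))) (allFin k)))
    where
    move : ∀ x → (λ (s : Vec (Fin k) n) → i + (ω x + weight s) ≤ d) ≐ (λ s → ω x + i + weight s ≤ d)
    move x = (λ {s} → subst (_≤ d) (x∙yz≈yx∙z i (ω x) (weight s)))
           , (λ {s} → subst (_≤ d) (sym (x∙yz≈yx∙z i (ω x) (weight s))))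

  #≤-anti : ∀ n {i j} d → i ≤ j → #≤ n j d ≤ #≤ n i d
  #≤-anti n {i} {j} d i≤j = card-mono {k} {n} (λ s → j + weight s ≤? d) (λ s → i + weight s ≤? d)
    λ {s} → ≤-trans (+-monoˡ-≤ (weight s) i≤j)

  #≤-shift : ∀ n i d → #≤ n (suc i) (suc d) ≡ #≤ n i d
  #≤-shift n i d = cong length (filter-≐ _ _ (s≤s⁻¹ , s≤s) (words k n))

  #≤-empty : ∀ n {i d} → d < i → #≤ n i d ≡ 0
  #≤-empty n {i} {d} d<i = cong length (filter-none _ (All.universal
    (λ s h → <⇒≱ d<i (≤-trans (m≤m+n i (weight s)) h)) (words k n)))

  #≤-zero : ∀ {i d} → i ≤ d → #≤ 0 i d ≡ 1
  #≤-zero {i} {d} i≤d = cong length (filter-accept (λ s → i + weight s ≤? d)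
    {xs = []} (subst (_≤ d) (sym (+-identityʳ i)) i≤d))

-- The graph

-- level x is the distance from vertex 0; depth x is at most the distance from vertex 5.
level : Fin 6 → ℕ
level 0F = 0
level 1F = 1
level 2F = 1
level 3F = 1
level 4F = 2
level 5F = 3

depth : Fin 6 → ℕ
depth x = 3 ∸ level x

Adj : Fin 6 → Fin 6 → Set
Adj u v = ∣ level u - level v ∣ ≡ 1

_++ʷ_ : ∀ {k} {_~_ : Fin k → Fin k → Set} {l m u v w} →
  Walk _~_ l u v → Walk _~_ m v w → Walk _~_ (l + m) u w
here     ++ʷ q = q
step e p ++ʷ q = step e (p ++ʷ q)

descend : ∀ u → Walk Adj (level u) u 0F
descend 0F = here
descend 1F = step refl here
descend 2F = step refl here
descend 3F = step refl here
descend 4F = step {v = 1F} refl (step refl here)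
descend 5F = step {v = 4F} refl (step {v = 1F} refl (step refl here))

ascend : ∀ u → Walk Adj (level u) 0F u
ascend 0F = here
ascend 1F = step refl here
ascend 2F = step refl here
ascend 3F = step refl here
ascend 4F = step {v = 1F} refl (step refl here)
ascend 5F = step {v = 1F} refl (step {v = 4F} refl (step refl here))

G : ConnectedGraph
G = record
  { order     = 6
  ; _~_       = Adj
  ; ~-sym     = λ {u} {v} → trans (∣-∣-comm (level v) (level u))
  ; ~-irrefl  = λ { {u} refl e → contradiction (trans (sym (∣n-n∣≡0 (level u))) e) λ () }
  ; ~-dec     = λ u v → ∣ level u - level v ∣ ≟ 1
  ; connected = λ u v → level u + level v , descend u ++ʷ ascend v
  }

open ConnectedGraph G using (dist-walk; dist-min)

-- Each edge changes the level by exactly one. This yields both the Lipschitz property of `X` and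
-- the lower bound on distances from 5.
walk-level : ∀ {l u v} → Walk Adj l u v → ∣ level u - level v ∣ ≤ l
walk-level {u = u} here = ≤-reflexive (∣n-n∣≡0 (level u))
walk-level {suc l} {u} {w} (step {v = v} e p) = begin
  ∣ level u - level w ∣                             ≤⟨ ∣-∣-triangle (level u) (level v) (level w) ⟩
  ∣ level u - level v ∣ + ∣ level v - level w ∣     ≤⟨ +-mono-≤ (≤-reflexive e) (walk-level p) ⟩
  suc l                                             ∎
  where open ≤-Reasoning

level-dist : ∀ u v → ∣ level u - level v ∣ ≤ dist G u v
level-dist u v = walk-level (dist-walk u v)

dist-adj : ∀ u v → Adj u v → dist G u v ≤ 1
dist-adj u v e = dist-min u v 1 (step e here)

dist-refl : ∀ u → dist G u u ≤ 0
dist-refl u = dist-min u u 0 here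

-- Distances in the powers of G

distⁿ-refl : ∀ {n} (u : Vertexⁿ G n) → distⁿ G u u ≤ 0
distⁿ-refl []      = z≤n
distⁿ-refl (x ∷ u) = +-mono-≤ (dist-refl x) (distⁿ-refl u)

-- A move of cost at most one away from 0. From 0 it reaches level 1, from any other vertex level at
-- least 2; vertex 5 has nowhere to go and stays.
up : Fin 6 → Fin 6
up 0F = 1F
up 4F = 5F
up 5F = 5F
up _  = 4F

dist-up : ∀ x → dist G x (up x) ≤ 1
dist-up 0F = dist-adj 0F 1F refl
dist-up 1F = dist-adj 1F 4F refl
dist-up 2F = dist-adj 2F 4F refl
dist-up 3F = dist-adj 3F 4F refl
dist-up 4F = dist-adj 4F 5F refl
dist-up 5F = ≤-trans (dist-refl 5F) z≤n

level-up : ∀ x → 1 ≤ level (up x)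
level-up 0F = s≤s z≤n
level-up 1F = s≤s z≤n
level-up 2F = s≤s z≤n
level-up 3F = s≤s z≤n
level-up 4F = s≤s z≤n
level-up 5F = s≤s z≤n

level-up₊ : ∀ i → 2 ≤ level (up (fsuc i))
level-up₊ 0F = s≤s (s≤s z≤n)
level-up₊ 1F = s≤s (s≤s z≤n)
level-up₊ 2F = s≤s (s≤s z≤n)
level-up₊ 3F = s≤s (s≤s z≤n)
level-up₊ 4F = s≤s (s≤s z≤n)

-- Apply `up` to the first d coordinates: each then contributes at least one to the weight.
climb : ∀ {n} d (u : Vertexⁿ G n) → d ≤ n →
  ∃[ a ] distⁿ G u a ≤ d × d ≤ weight level a
climb zero    u       _       = u , distⁿ-refl u , z≤n
climb (suc d) (x ∷ u) (s≤s h) with climb d u h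
... | a , near , high = up x ∷ a , +-mono-≤ (dist-up x) near , +-mono-≤ (level-up x) high

-- The extra unit over `climb` comes from a nonzero coordinate: if it is among those moved it ends
-- at level at least 2, and otherwise its level was not yet counted. Hence only the origin can
-- escape the d-neighbourhood of the words of weight above d.
climb₊ : ∀ {n} d (u : Vertexⁿ G n) → d < n → 1 ≤ weight level u →
  ∃[ a ] distⁿ G u a ≤ d × d < weight level a
climb₊ zero    u              _       u>0 = u , distⁿ-refl u , u>0
climb₊ (suc d) (0F     ∷ u) (s≤s h) u>0 with climb₊ d u h u>0
... | a , near , high = 1F ∷ a , +-mono-≤ (dist-up 0F) near , s≤s high
climb₊ (suc d) (fsuc i ∷ u) (s≤s h) u>0 with climb d u (<⇒≤ h)
... | a , near , high =
  up (fsuc i) ∷ a , +-mono-≤ (dist-up (fsuc i)) near , +-mono-≤ (level-up₊ i) high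

depth≤dist : ∀ x → depth x ≤ dist G 5F x
depth≤dist x = ≤-trans (m∸n≤∣m-n∣ 3 (level x)) (level-dist 5F x)

-- Total depth 0 forces every entry of u to be 5, and `depth≤dist` then applies in each coordinate.
weight-depth≤distⁿ : ∀ {n} (u v : Vertexⁿ G n) → weight depth u ≤ 0 → weight depth v ≤ distⁿ G u v
weight-depth≤distⁿ []       []      _ = z≤n
weight-depth≤distⁿ (0F ∷ _) (_ ∷ _) ()
weight-depth≤distⁿ (1F ∷ _) (_ ∷ _) ()
weight-depth≤distⁿ (2F ∷ _) (_ ∷ _) ()
weight-depth≤distⁿ (3F ∷ _) (_ ∷ _) ()
weight-depth≤distⁿ (4F ∷ _) (_ ∷ _) ()
weight-depth≤distⁿ (5F ∷ u) (y ∷ v) h = +-mono-≤ (depth≤dist y) (weight-depth≤distⁿ u v h)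

-- Sizes of the balls around 0ⁿ and 5ⁿ

#level-suc : ∀ n i d → #≤ level (suc n) i d ≡
  #≤ level n i d + 3 * #≤ level n (1 + i) d + #≤ level n (2 + i) d + #≤ level n (3 + i) d
#level-suc n i d = trans (#≤-suc level n i d)
  (solve 4 (λ a b c e → a :+ (b :+ (b :+ (b :+ (c :+ (e :+ con 0))))) := a :+ con 3 :* b :+ c :+ e)
    refl (f 0) (f 1) (f 2) (f 3))
  where f = λ j → #≤ level n (j + i) d

#level-≤-suc : ∀ n d → #≤ level n 0 d ≤ #≤ level (suc n) 0 d
#level-≤-suc n d = ≤-trans (≤-trans (m≤m+n _ _) (≤-trans (m≤m+n _ _) (m≤m+n _ _)))
  (≤-reflexive (sym (#level-suc n 0 d)))

#depth-suc : ∀ n i d → #≤ depth (suc n) i d ≡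
  #≤ depth n i d + #≤ depth n (1 + i) d + 3 * #≤ depth n (2 + i) d + #≤ depth n (3 + i) d
#depth-suc n i d = trans (#≤-suc depth n i d)
  (solve 4 (λ a b c e → e :+ (c :+ (c :+ (c :+ (b :+ (a :+ con 0))))) := a :+ b :+ con 3 :* c :+ e)
    refl (f 0) (f 1) (f 2) (f 3))
  where f = λ j → #≤ depth n (j + i) d

-- Σbinom n 0 d = Σ_{j ≤ d} n C j, counted as binary words of length n with at most d ones.
Σbinom : ℕ → ℕ → ℕ → ℕ
Σbinom = #≤ {2} toℕ

Σbinom-suc : ∀ n i d → Σbinom (suc n) i d ≡ Σbinom n i d + Σbinom n (1 + i) d
Σbinom-suc n i d = trans (#≤-suc toℕ n i d) (cong (λ z → Σbinom n i d + z) (+-identityʳ _))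

-- An exponential-moment bound: weighting each letter x by 4 to the power -level x gives total 1 +
-- 3/4 + 1/16 + 1/64 ≤ 2 per coordinate. It is crude, but suffices to show that the ball fills at
-- most half of the space.
#level-upper : ∀ n i d → 4 ^ i * #≤ level n i d ≤ 4 ^ d * 2 ^ n
#level-upper zero i d with i ≤? d
... | yes i≤d rewrite #≤-zero level i≤d = *-monoˡ-≤ 1 (^-monoʳ-≤ 4 i≤d)
... | no  i≰d rewrite #≤-empty level 0 (≰⇒> i≰d) = subst (_≤ 4 ^ d * 1) (sym (*-zeroʳ (4 ^ i))) z≤n
#level-upper (suc n) i d = *-cancelˡ-≤ 64 (begin
  64 * (4 ^ i * #≤ level (suc n) i d)
    ≡⟨ cong (λ x → 64 * (4 ^ i * x)) (#level-suc n i d) ⟩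
  64 * (4 ^ i * (f 0 + 3 * f 1 + f 2 + f 3))
    ≡⟨ solve 5 (λ p a b c e → con 64 :* (p :* (a :+ con 3 :* b :+ c :+ e)) :=
         con 64 :* (p :* a) :+ con 48 :* (con 4 :* p :* b) :+ con 4 :* (con 4 :* (con 4 :* p) :* c)
           :+ con 4 :* (con 4 :* (con 4 :* p)) :* e)
         refl (4 ^ i) (f 0) (f 1) (f 2) (f 3) ⟩
  64 * (4 ^ i * f 0) + 48 * (4 ^ (1 + i) * f 1) + 4 * (4 ^ (2 + i) * f 2) + 4 ^ (3 + i) * f 3
    ≤⟨ +-mono-≤ (+-mono-≤ (+-mono-≤ (*-monoʳ-≤ 64 (#level-upper n i d)) (*-monoʳ-≤ 48 (#level-upper n (1 + i) d)))
         (*-monoʳ-≤ 4 (#level-upper n (2 + i) d))) (#level-upper n (3 + i) d) ⟩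
  64 * b + 48 * b + 4 * b + b
    -- 64 + 48 + 4 + 1 = 117, and 11 more make 128 = 64 · 2.
    ≤⟨ m≤m+n _ (11 * b) ⟩
  64 * b + 48 * b + 4 * b + b + 11 * b
    ≡⟨ solve 2 (λ p q → let b = p :* q in
         con 64 :* b :+ con 48 :* b :+ con 4 :* b :+ b :+ con 11 :* b := con 64 :* (p :* (con 2 :* q)))
         refl (4 ^ d) (2 ^ n) ⟩
  64 * (4 ^ d * 2 ^ suc n) ∎)
  where
  open ≤-Reasoning
  f = λ j → #≤ level n (j + i) d
  b = 4 ^ d * 2 ^ n

-- 5/2 works because 2/5 + 3 (2/5)² + (2/5)³ ≤ 1; being below 3, it is beaten by #level-lower.
#depth-upper : ∀ n i d → 5 ^ i * 2 ^ d * #≤ depth n i d ≤ 5 ^ d * 2 ^ i * Σbinom n i d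
#depth-upper zero i d with i ≤? d
... | no  i≰d rewrite #≤-empty depth 0 (≰⇒> i≰d) =
  subst (_≤ 5 ^ d * 2 ^ i * Σbinom 0 i d) (sym (*-zeroʳ (5 ^ i * 2 ^ d))) z≤n
... | yes i≤d rewrite #≤-zero depth i≤d | #≤-zero (toℕ {2}) i≤d = *-monoˡ-≤ 1 (begin
  5 ^ i * 2 ^ d                    ≡⟨ cong (λ x → 5 ^ i * 2 ^ x) (m+[n∸m]≡n i≤d) ⟨
  5 ^ i * 2 ^ (i + j)              ≡⟨ cong (5 ^ i *_) (^-distribˡ-+-* 2 i j) ⟩
  -- For the empty word the claim is 2^j ≤ 5^j with j = d ∸ i.
  5 ^ i * (2 ^ i * 2 ^ j)          ≤⟨ *-monoʳ-≤ (5 ^ i) (*-monoʳ-≤ (2 ^ i) (^-monoˡ-≤ j (s≤s (s≤s z≤n)))) ⟩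
  5 ^ i * (2 ^ i * 5 ^ j)          ≡⟨ solve 3 (λ p q r → p :* (q :* r) := p :* r :* q) refl (5 ^ i) (2 ^ i) (5 ^ j) ⟩
  5 ^ i * 5 ^ j * 2 ^ i            ≡⟨ cong (_* 2 ^ i) (^-distribˡ-+-* 5 i j) ⟨
  5 ^ (i + j) * 2 ^ i              ≡⟨ cong (λ x → 5 ^ x * 2 ^ i) (m+[n∸m]≡n i≤d) ⟩
  5 ^ d * 2 ^ i                    ∎)
  where
  open ≤-Reasoning
  j = d ∸ i
#depth-upper (suc n) i d = *-cancelˡ-≤ 125 (begin
  125 * (5 ^ i * 2 ^ d * #≤ depth (suc n) i d)
    ≡⟨ cong (λ x → 125 * (5 ^ i * 2 ^ d * x)) (#depth-suc n i d) ⟩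
  125 * (5 ^ i * 2 ^ d * (f 0 + f 1 + 3 * f 2 + f 3))
    ≡⟨ solve 6 (λ p q a b c e → con 125 :* (p :* q :* (a :+ b :+ con 3 :* c :+ e)) :=
         con 125 :* (p :* q :* a) :+ con 25 :* (con 5 :* p :* q :* b)
           :+ con 15 :* (con 5 :* (con 5 :* p) :* q :* c) :+ con 5 :* (con 5 :* (con 5 :* p)) :* q :* e)
         refl (5 ^ i) (2 ^ d) (f 0) (f 1) (f 2) (f 3) ⟩
  125 * (5 ^ i * 2 ^ d * f 0) + 25 * (5 ^ (1 + i) * 2 ^ d * f 1)
    + 15 * (5 ^ (2 + i) * 2 ^ d * f 2) + 5 ^ (3 + i) * 2 ^ d * f 3
    ≤⟨ +-mono-≤ (+-mono-≤ (+-mono-≤ (*-monoʳ-≤ 125 (#depth-upper n i d)) (*-monoʳ-≤ 25 (shifted 1 ≤-refl)))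
         (*-monoʳ-≤ 15 (shifted 2 (s≤s z≤n)))) (shifted 3 (s≤s z≤n)) ⟩
  125 * (5 ^ d * 2 ^ i * g 0) + 25 * (5 ^ d * 2 ^ (1 + i) * g 1)
    + 15 * (5 ^ d * 2 ^ (2 + i) * g 1) + 5 ^ d * 2 ^ (3 + i) * g 1
    -- The coefficients of `g 1` are 25 · 2 + 15 · 4 + 8 = 118, which is 7 short of 125.
    ≤⟨ m≤m+n _ (7 * (5 ^ d * 2 ^ i * g 1)) ⟩
  125 * (5 ^ d * 2 ^ i * g 0) + 25 * (5 ^ d * 2 ^ (1 + i) * g 1)
    + 15 * (5 ^ d * 2 ^ (2 + i) * g 1) + 5 ^ d * 2 ^ (3 + i) * g 1 + 7 * (5 ^ d * 2 ^ i * g 1)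
    ≡⟨ solve 4 (λ p q a b → con 125 :* (p :* q :* a) :+ con 25 :* (p :* (con 2 :* q) :* b)
           :+ con 15 :* (p :* (con 2 :* (con 2 :* q)) :* b) :+ p :* (con 2 :* (con 2 :* (con 2 :* q))) :* b
           :+ con 7 :* (p :* q :* b) := con 125 :* (p :* q :* (a :+ b)))
         refl (5 ^ d) (2 ^ i) (g 0) (g 1) ⟩
  125 * (5 ^ d * 2 ^ i * (g 0 + g 1))
    ≡⟨ cong (λ x → 125 * (5 ^ d * 2 ^ i * x)) (Σbinom-suc n i d) ⟨
  125 * (5 ^ d * 2 ^ i * Σbinom (suc n) i d) ∎)
  where
  open ≤-Reasoning
  f = λ j → #≤ depth n (j + i) d
  g = λ j → Σbinom n (j + i) d
  -- Letters of depth 1, 2 and 3 all become the single letter one of a binary word; lowering the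
  -- offset only enlarges the binary count.
  shifted : ∀ j → 1 ≤ j → 5 ^ (j + i) * 2 ^ d * f j ≤ 5 ^ d * 2 ^ (j + i) * g 1
  shifted j 1≤j = ≤-trans (#depth-upper n (j + i) d)
    (*-monoʳ-≤ (5 ^ d * 2 ^ (j + i)) (#≤-anti toℕ n d (+-monoˡ-≤ i 1≤j)))

-- Choose d positions and fill each with one of the three vertices of level 1, with 0 elsewhere. In
-- the induction this is Pascal's rule, with the summands of levels 2 and 3 dropped.
#level-lower : ∀ n d → 3 ^ d * n C d ≤ #≤ level n 0 d
#level-lower zero    zero    = ≤-refl
#level-lower zero    (suc d) rewrite k>n⇒nCk≡0 {0} {suc d} (s≤s z≤n) | *-zeroʳ (3 ^ suc d) = z≤n
#level-lower (suc n) zero    = ≤-trans (#level-lower n 0) (#level-≤-suc n 0)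
#level-lower (suc n) (suc d) = begin
  3 ^ suc d * suc n C suc d
    ≡⟨ cong (3 ^ suc d *_) (nCk+nC[k+1]≡[n+1]C[k+1] n d) ⟨
  3 ^ suc d * (n C d + n C suc d)
    ≡⟨ solve 3 (λ p a b → con 3 :* p :* (a :+ b) := con 3 :* p :* b :+ con 3 :* (p :* a)) refl (3 ^ d) (n C d) (n C suc d) ⟩
  3 ^ suc d * n C suc d + 3 * (3 ^ d * n C d)
    ≤⟨ +-mono-≤ (#level-lower n (suc d)) (*-monoʳ-≤ 3 (#level-lower n d)) ⟩
  #≤ level n 0 (suc d) + 3 * #≤ level n 0 d
    ≡⟨ cong (λ x → #≤ level n 0 (suc d) + 3 * x) (#≤-shift level n 0 d) ⟨
  #≤ level n 0 (suc d) + 3 * #≤ level n 1 (suc d)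
    ≤⟨ m≤m+n _ _ ⟩
  _ ≤⟨ m≤m+n _ _ ⟩
  _ ≡⟨ #level-suc n 0 (suc d) ⟨
  #≤ level (suc n) 0 (suc d) ∎
  where open ≤-Reasoning

-- Partial sums of binomial coefficients, and the comparison of the two balls

nC0≡1 : ∀ n → n C 0 ≡ 1
nC0≡1 n = trans (nCk≡nC[n∸k] {0} {n} z≤n) (nCn≡1 n)

Σbinom-zero : ∀ n → Σbinom n 0 0 ≡ 1
Σbinom-zero zero    = refl
Σbinom-zero (suc n) = trans (Σbinom-suc n 0 0) (cong₂ _+_ (Σbinom-zero n) (#≤-empty toℕ n (s≤s z≤n)))

Σbinom-step : ∀ n d → Σbinom n 0 (suc d) ≡ Σbinom n 0 d + n C suc d
Σbinom-step zero    d = cong (λ z → 1 + z) (sym (k>n⇒nCk≡0 {0} {suc d} (s≤s z≤n)))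
Σbinom-step (suc n) d = begin
  Σbinom (suc n) 0 (suc d)                              ≡⟨ Σbinom-suc n 0 (suc d) ⟩
  Σbinom n 0 (suc d) + Σbinom n 1 (suc d)               ≡⟨ cong₂ _+_ (Σbinom-step n d) (#≤-shift toℕ n 0 d) ⟩
  Σbinom n 0 d + n C suc d + Σbinom n 0 d               ≡⟨ solve 2 (λ a b → a :+ b :+ a := a :+ a :+ b) refl (Σbinom n 0 d) (n C suc d) ⟩
  Σbinom n 0 d + Σbinom n 0 d + n C suc d               ≡⟨ cong (_+ n C suc d) (double d) ⟨
  Σbinom (suc n) 0 d + n C d + n C suc d                ≡⟨ +-assoc (Σbinom (suc n) 0 d) _ _ ⟩
  Σbinom (suc n) 0 d + (n C d + n C suc d)              ≡⟨ cong (λ z → Σbinom (suc n) 0 d + z) (nCk+nC[k+1]≡[n+1]C[k+1] n d) ⟩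
  Σbinom (suc n) 0 d + suc n C suc d                    ∎
  where
  open ≡-Reasoning
  -- Of the two sums obtained from the first letter, the one for letter one stops at d - 1 and so
  -- lacks the term n C d.
  double : ∀ d → Σbinom (suc n) 0 d + n C d ≡ Σbinom n 0 d + Σbinom n 0 d
  double zero    = trans (cong₂ _+_ (Σbinom-zero (suc n)) (nC0≡1 n)) (sym (cong₂ _+_ (Σbinom-zero n) (Σbinom-zero n)))
  double (suc e) = begin
    Σbinom (suc n) 0 (suc e) + n C suc e                  ≡⟨ cong (_+ n C suc e) (Σbinom-suc n 0 (suc e)) ⟩
    Σbinom n 0 (suc e) + Σbinom n 1 (suc e) + n C suc e   ≡⟨ cong (λ x → Σbinom n 0 (suc e) + x + n C suc e) (#≤-shift toℕ n 0 e) ⟩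
    Σbinom n 0 (suc e) + Σbinom n 0 e + n C suc e         ≡⟨ +-assoc (Σbinom n 0 (suc e)) _ _ ⟩
    Σbinom n 0 (suc e) + (Σbinom n 0 e + n C suc e)       ≡⟨ cong (λ z → Σbinom n 0 (suc e) + z) (Σbinom-step n e) ⟨
    Σbinom n 0 (suc e) + Σbinom n 0 (suc e)               ∎

-- The ratio of consecutive binomials, (n - k) / (k + 1), stated without subtraction.
[k+1]*nC[k+1]+k*nCk≡n*nCk : ∀ n k → suc k * n C suc k + k * n C k ≡ n * n C k
[k+1]*nC[k+1]+k*nCk≡n*nCk n       zero    rewrite nC1≡n n | nC0≡1 n = solve 1 (λ n → con 1 :* n :+ con 0 := n :* con 1) refl n
[k+1]*nC[k+1]+k*nCk≡n*nCk zero    (suc k)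
  rewrite k>n⇒nCk≡0 {0} {suc k} (s≤s z≤n) | k>n⇒nCk≡0 {0} {2 + k} (s≤s z≤n) = cong₂ _+_ (*-zeroʳ k) (*-zeroʳ k)
[k+1]*nC[k+1]+k*nCk≡n*nCk (suc n) (suc k) = begin
  (2 + k) * suc n C (2 + k) + suc k * suc n C suc k
    ≡⟨ cong₂ (λ x y → (2 + k) * x + suc k * y) (nCk+nC[k+1]≡[n+1]C[k+1] n (suc k)) (nCk+nC[k+1]≡[n+1]C[k+1] n k) ⟨
  (2 + k) * (b + c) + suc k * (a + b)
    ≡⟨ solve 4 (λ k a b c → (con 2 :+ k) :* (b :+ c) :+ (con 1 :+ k) :* (a :+ b) :=
         ((con 2 :+ k) :* c :+ (con 1 :+ k) :* b) :+ ((con 1 :+ k) :* b :+ k :* a) :+ (a :+ b)) refl k a b c ⟩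
  ((2 + k) * c + suc k * b) + (suc k * b + k * a) + (a + b)
    ≡⟨ cong₂ (λ x y → x + y + (a + b)) ([k+1]*nC[k+1]+k*nCk≡n*nCk n (suc k)) ([k+1]*nC[k+1]+k*nCk≡n*nCk n k) ⟩
  n * b + n * a + (a + b)
    ≡⟨ solve 3 (λ n a b → n :* b :+ n :* a :+ (a :+ b) := (con 1 :+ n) :* (a :+ b)) refl n a b ⟩
  suc n * (a + b)
    ≡⟨ cong (suc n *_) (nCk+nC[k+1]≡[n+1]C[k+1] n k) ⟩
  suc n * suc n C suc k ∎
  where
  open ≡-Reasoning
  a = n C k
  b = n C suc k
  c = n C (2 + k)

-- The ratio (n - k) / (k + 1) is at least 2 in this range.
2*nCk≤nC[k+1] : ∀ n k → 3 * suc k ≤ n → 2 * n C k ≤ n C suc k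
2*nCk≤nC[k+1] n k h = *-cancelˡ-≤ (suc k) (+-cancelʳ-≤ (k * n C k) _ _ (begin
  suc k * (2 * n C k) + k * n C k     ≤⟨ m≤m+n _ (n C k) ⟩
  suc k * (2 * n C k) + k * n C k + n C k
    ≡⟨ solve 2 (λ k a → (con 1 :+ k) :* (con 2 :* a) :+ k :* a :+ a := con 3 :* (con 1 :+ k) :* a) refl k (n C k) ⟩
  3 * suc k * n C k                   ≤⟨ *-monoˡ-≤ (n C k) h ⟩
  n * n C k                           ≡⟨ [k+1]*nC[k+1]+k*nCk≡n*nCk n k ⟨
  suc k * n C suc k + k * n C k       ∎))
  where open ≤-Reasoning

-- Terms that at least double at each step sum to at most twice the last one.
Σbinom≤2*nCk : ∀ n k → 3 * k ≤ n → Σbinom n 0 k ≤ 2 * n C k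
Σbinom≤2*nCk n zero    h rewrite Σbinom-zero n | nC0≡1 n = s≤s z≤n
Σbinom≤2*nCk n (suc k) h = begin
  Σbinom n 0 (suc k)            ≡⟨ Σbinom-step n k ⟩
  Σbinom n 0 k + n C suc k      ≤⟨ +-monoˡ-≤ (n C suc k) (≤-trans (Σbinom≤2*nCk n k (≤-trans (*-monoʳ-≤ 3 (n≤1+n k)) h)) (2*nCk≤nC[k+1] n k h)) ⟩
  n C suc k + n C suc k         ≡⟨ solve 1 (λ a → a :+ a := con 2 :* a) refl (n C suc k) ⟩
  2 * n C suc k                 ∎
  where open ≤-Reasoning

12*5^-≤-6^ : ∀ k → 12 * 5 ^ k ≤ 6 ^ k → ∀ j → 12 * 5 ^ (j + k) ≤ 6 ^ (j + k)
12*5^-≤-6^ k h zero    = h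
12*5^-≤-6^ k h (suc j) = begin
  12 * (5 * 5 ^ (j + k))     ≡⟨ solve 1 (λ p → con 12 :* (con 5 :* p) := con 5 :* (con 12 :* p)) refl (5 ^ (j + k)) ⟩
  5 * (12 * 5 ^ (j + k))     ≤⟨ *-mono-≤ (n≤1+n 5) (12*5^-≤-6^ k h j) ⟩
  6 * 6 ^ (j + k)            ∎
  where open ≤-Reasoning

-- 14 is the least exponent at which (6/5)^d exceeds 12; every later 14 stems from here.
12*5^d≤6^d : ∀ d → 14 ≤ d → 12 * 5 ^ d ≤ 6 ^ d
12*5^d≤6^d d 14≤d = subst (λ x → 12 * 5 ^ x ≤ 6 ^ x) (m∸n+n≡m 14≤d)
  (12*5^-≤-6^ 14 (≤ᵇ⇒≤ (12 * 5 ^ 14) (6 ^ 14) _) (d ∸ 14))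

6^d≡2^d*3^d : ∀ d → 6 ^ d ≡ 2 ^ d * 3 ^ d
6^d≡2^d*3^d zero    = refl
6^d≡2^d*3^d (suc d) = trans (cong (6 *_) (6^d≡2^d*3^d d))
  (solve 2 (λ p q → con 6 :* (p :* q) := con 2 :* p :* (con 3 :* q)) refl (2 ^ d) (3 ^ d))

-- Both sides are compared with m C d: the left is at most 12 (5/2)^d times it, the right at least
-- 3^d times it. Multiplying by 2^d keeps the chain in ℕ.
6*#depth≤#level : ∀ m d → 14 ≤ d → 3 * d ≤ m → 6 * #≤ depth m 0 d ≤ #≤ level (suc m) 0 d
6*#depth≤#level m d 14≤d 3d≤m = *-cancelˡ-≤ (2 ^ d) {{m^n≢0 2 d}} (begin
  2 ^ d * (6 * #≤ depth m 0 d)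
    ≡⟨ solve 2 (λ p a → p :* (con 6 :* a) := con 6 :* (con 1 :* p :* a)) refl (2 ^ d) (#≤ depth m 0 d) ⟩
  6 * (1 * 2 ^ d * #≤ depth m 0 d)
    ≤⟨ *-monoʳ-≤ 6 (#depth-upper m 0 d) ⟩
  6 * (5 ^ d * 1 * Σbinom m 0 d)
    ≤⟨ *-monoʳ-≤ 6 (*-monoʳ-≤ (5 ^ d * 1) (Σbinom≤2*nCk m d 3d≤m)) ⟩
  6 * (5 ^ d * 1 * (2 * m C d))
    ≡⟨ solve 2 (λ p a → con 6 :* (p :* con 1 :* (con 2 :* a)) := con 12 :* p :* a) refl (5 ^ d) (m C d) ⟩
  12 * 5 ^ d * m C d
    ≤⟨ *-monoˡ-≤ (m C d) (12*5^d≤6^d d 14≤d) ⟩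
  6 ^ d * m C d
    ≡⟨ cong (_* m C d) (6^d≡2^d*3^d d) ⟩
  2 ^ d * 3 ^ d * m C d
    ≡⟨ *-assoc (2 ^ d) (3 ^ d) (m C d) ⟩
  2 ^ d * (3 ^ d * m C d)
    ≤⟨ *-monoʳ-≤ (2 ^ d) (#level-lower m d) ⟩
  2 ^ d * #≤ level m 0 d
    ≤⟨ *-monoʳ-≤ (2 ^ d) (#level-≤-suc m d) ⟩
  2 ^ d * #≤ level (suc m) 0 d ∎)
  where open ≤-Reasoning

#level-zero : ∀ n → #≤ level n 0 0 ≡ 1
#level-zero zero    = refl
#level-zero (suc n) = trans (#level-suc n 0 0)
  (cong₂ _+_ (cong₂ _+_ (cong₂ (λ x y → x + 3 * y) (#level-zero n) (empty 0)) (empty 1)) (empty 2))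
  where
  empty : ∀ i → #≤ level n (suc i) 0 ≡ 0
  empty i = #≤-empty level n (s≤s z≤n)

1≤#depth : ∀ n → 1 ≤ #≤ depth n 0 0
1≤#depth zero    = ≤-refl
1≤#depth (suc n) = ≤-trans (1≤#depth n)
  (≤-trans (≤-trans (m≤m+n _ _) (≤-trans (m≤m+n _ _) (m≤m+n _ _))) (≤-reflexive (sym (#depth-suc n 0 0))))

-- Variance-optimality

open ℚSolver.+-*-Solver using (_:-_; :-_)
  renaming (solve to ℚ-solve; con to ℚ-con; _:+_ to _:⊕_; _:*_ to _:⊗_; _:=_ to _:≈_)

-- The final 0ℚ mirrors the end of the fold in `sumᴿ`, so that `var₆` agrees by computation with
-- each term of `Var G Y`.
avg₆ : (v a b c t e : ℚ) → ℚ
avg₆ v a b c t e = + 1 ℚ./ 6 ℚ.* (v ℚ.+ (a ℚ.+ (b ℚ.+ (c ℚ.+ (t ℚ.+ (e ℚ.+ 0ℚ))))))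

var₆ : (v a b c t e : ℚ) → ℚ
var₆ v a b c t e = avg₆ (sq v) (sq a) (sq b) (sq c) (sq t) (sq e)
  where
  m = avg₆ v a b c t e
  sq : ℚ → ℚ
  sq x = (x ℚ.- m) ℚ.* (x ℚ.- m)

-- With p = x - v and q = t - x for x ∈ {a, b, c}, s = e - t and g = t - v = p + q, this is the total slack in
-- p² + q² ≤ (g - L)² + L², (q + s)² ≤ 4L², (p - p′)² ≤ (2L - g)², (g + s)² ≤ (g + L)², s² ≤ L² and 8g(2L - g) ≥ 0.
slack : (v a b c t e L : ℚ) → ℚ
slack v a b c t e L =
     (P a ℚ.+ P b ℚ.+ P c)
     ℚ.+ (R a ℚ.+ R b ℚ.+ R c)
     ℚ.+ (T a b ℚ.+ T b c ℚ.+ T c a)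
     ℚ.+ (L ℚ.- (e ℚ.- t)) ℚ.* ((t ℚ.- v) ℚ.+ (t ℚ.- v) ℚ.+ (L ℚ.+ (e ℚ.- t)))
     ℚ.+ (L ℚ.- (e ℚ.- t)) ℚ.* (L ℚ.+ (e ℚ.- t))
     ℚ.+ (+ 8 ℚ./ 1) ℚ.* ((t ℚ.- v) ℚ.* (L ℚ.+ L ℚ.- (t ℚ.- v)))
  where
  P R : ℚ → ℚ
  P x = (+ 2 ℚ./ 1) ℚ.* ((L ℚ.- (x ℚ.- v)) ℚ.* (L ℚ.- (t ℚ.- x)))
  R x = (L ℚ.+ L ℚ.- (e ℚ.- x)) ℚ.* (L ℚ.+ L ℚ.+ (e ℚ.- x))
  T : ℚ → ℚ → ℚ
  T x y = (L ℚ.+ L ℚ.- (t ℚ.- v) ℚ.- (x ℚ.- y)) ℚ.* (L ℚ.+ L ℚ.- (t ℚ.- v) ℚ.+ (x ℚ.- y))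

-- 36 times the variance is the sum of the squared differences over the 15 pairs of vertices;
-- keeping g² and bounding the other 14 as in `slack` leaves 32L² - 8g(2L - g).
var₆+slack : ∀ v a b c t e L → var₆ v a b c t e ℚ.+ (+ 1 ℚ./ 36) ℚ.* slack v a b c t e L ≡ (+ 8 ℚ./ 9) ℚ.* (L ℚ.* L)
var₆+slack = ℚ-solve 7 (λ v a b c t e L →
   let avg = λ v a b c t e → ℚ-con (+ 1 ℚ./ 6) :⊗ (v :⊕ (a :⊕ (b :⊕ (c :⊕ (t :⊕ (e :⊕ ℚ-con 0ℚ))))))
       m = avg v a b c t e
       sq = λ x → (x :- m) :⊗ (x :- m)
       P = λ x → ℚ-con (+ 2 ℚ./ 1) :⊗ ((L :- (x :- v)) :⊗ (L :- (t :- x)))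
       R = λ x → (L :⊕ L :- (e :- x)) :⊗ (L :⊕ L :⊕ (e :- x))
       T = λ x y → (L :⊕ L :- (t :- v) :- (x :- y)) :⊗ (L :⊕ L :- (t :- v) :⊕ (x :- y))
   in avg (sq v) (sq a) (sq b) (sq c) (sq t) (sq e) :⊕ ℚ-con (+ 1 ℚ./ 36) :⊗ (
     (P a :⊕ P b :⊕ P c)
     :⊕ (R a :⊕ R b :⊕ R c)
     :⊕ (T a b :⊕ T b c :⊕ T c a)
     :⊕ (L :- (e :- t)) :⊗ ((t :- v) :⊕ (t :- v) :⊕ (L :⊕ (e :- t)))
     :⊕ (L :- (e :- t)) :⊗ (L :⊕ (e :- t))
     :⊕ ℚ-con (+ 8 ℚ./ 1) :⊗ ((t :- v) :⊗ (L :⊕ L :- (t :- v)))) :≈ ℚ-con (+ 8 ℚ./ 9) :⊗ (L :⊗ L)) refl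

0≤+ : ∀ {p q} → 0ℚ ℚ.≤ p → 0ℚ ℚ.≤ q → 0ℚ ℚ.≤ p ℚ.+ q
0≤+ = ℚₚ.+-mono-≤

0≤* : ∀ {p q} → 0ℚ ℚ.≤ p → 0ℚ ℚ.≤ q → 0ℚ ℚ.≤ p ℚ.* q
0≤* {p} {q} p≥0 q≥0 = subst (ℚ._≤ p ℚ.* q) (ℚₚ.*-zeroʳ p) (ℚₚ.*-monoˡ-≤-nonNeg p {{ℚ.nonNegative p≥0}} q≥0)

p≤q⇒0≤q-p : ∀ {p q} → p ℚ.≤ q → 0ℚ ℚ.≤ q ℚ.- p
p≤q⇒0≤q-p {p} {q} p≤q = subst (ℚ._≤ q ℚ.- p) (ℚₚ.+-inverseʳ p) (ℚₚ.+-monoˡ-≤ (ℚ.- p) p≤q)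

p≤∣p∣ : ∀ p → p ℚ.≤ ℚ.∣ p ∣
p≤∣p∣ p with ℚₚ.≤-total 0ℚ p
... | inj₁ p≥0 = ℚₚ.≤-reflexive (sym (ℚₚ.0≤p⇒∣p∣≡p p≥0))
... | inj₂ p≤0 = ℚₚ.≤-trans p≤0 (ℚₚ.0≤∣p∣ p)

var₆-neg : ∀ v a b c t e → var₆ (ℚ.- v) (ℚ.- a) (ℚ.- b) (ℚ.- c) (ℚ.- t) (ℚ.- e) ≡ var₆ v a b c t e
var₆-neg = ℚ-solve 6 (λ v a b c t e →
   let avg = λ v a b c t e → ℚ-con (+ 1 ℚ./ 6) :⊗ (v :⊕ (a :⊕ (b :⊕ (c :⊕ (t :⊕ (e :⊕ ℚ-con 0ℚ))))))
       var = λ v a b c t e →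
         let m = avg v a b c t e
             sq = λ x → (x :- m) :⊗ (x :- m)
         in avg (sq v) (sq a) (sq b) (sq c) (sq t) (sq e)
   in var (:- v) (:- a) (:- b) (:- c) (:- t) (:- e) :≈ var v a b c t e) refl

-- Wrapped in a record so that x and y can be inferred from the type.
record Close (L x y : ℚ) : Set where
  constructor close
  field distance≤ : ℚ.∣ x ℚ.- y ∣ ℚ.≤ L

module _ (L : ℚ) where
  upper : ∀ {x y} → Close L x y → 0ℚ ℚ.≤ L ℚ.- (x ℚ.- y)
  upper {x} {y} (close h) = p≤q⇒0≤q-p (ℚₚ.≤-trans (p≤∣p∣ (x ℚ.- y)) h)

  Close-sym : ∀ {x y} → Close L x y → Close L y x
  Close-sym {x} {y} (close h) = close (subst (ℚ._≤ L)
    (trans (sym (ℚₚ.∣-p∣≡∣p∣ (x ℚ.- y))) (cong ℚ.∣_∣ (ℚ-solve 2 (λ x y → :- (x :- y) :≈ y :- x) refl x y))) h)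

  lower : ∀ {x y} → Close L x y → 0ℚ ℚ.≤ L ℚ.+ (x ℚ.- y)
  lower {x} {y} h = subst (0ℚ ℚ.≤_) (ℚ-solve 3 (λ L x y → L :- (y :- x) :≈ L :⊕ (x :- y)) refl L x y) (upper (Close-sym h))

  Close-neg : ∀ {x y} → Close L x y → Close L (ℚ.- x) (ℚ.- y)
  Close-neg {x} {y} h = close (subst (λ z → ℚ.∣ z ∣ ℚ.≤ L) (ℚ-solve 2 (λ x y → y :- x :≈ :- x :- :- y) refl x y)
    (Close.distance≤ (Close-sym h)))

  -- Every summand of `slack` is a product of nonnegative factors, each bounded along a path of G; v
  -- ≤ t settles those containing g. The opposite case follows by negating all values.
  var₆≤-pos : ∀ v a b c t e →
    Close L a v → Close L b v → Close L c v → Close L t a → Close L t b → Close L t c → Close L e t →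
    v ℚ.≤ t → var₆ v a b c t e ℚ.≤ + 8 ℚ./ 9 ℚ.* (L ℚ.* L)
  var₆≤-pos v a b c t e va vb vc at bt ct te v≤t =
    subst₂ ℚ._≤_ (ℚₚ.+-identityʳ _) (var₆+slack v a b c t e L)
      (ℚₚ.+-monoʳ-≤ (var₆ v a b c t e) {0ℚ} (0≤* {+ 1 ℚ./ 36} (ℚₚ.nonNegative⁻¹ _) slack≥0))
    where
    g≥0 : 0ℚ ℚ.≤ t ℚ.- v
    g≥0 = p≤q⇒0≤q-p v≤t
    P≥0 : ∀ {x} → Close L x v → Close L t x → 0ℚ ℚ.≤ + 2 ℚ./ 1 ℚ.* ((L ℚ.- (x ℚ.- v)) ℚ.* (L ℚ.- (t ℚ.- x)))
    P≥0 h k = 0≤* {+ 2 ℚ./ 1} (ℚₚ.nonNegative⁻¹ _) (0≤* (upper h) (upper k))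
    R≥0 : ∀ {x} → Close L t x → 0ℚ ℚ.≤ (L ℚ.+ L ℚ.- (e ℚ.- x)) ℚ.* (L ℚ.+ L ℚ.+ (e ℚ.- x))
    R≥0 {x} k = 0≤*
      (subst (0ℚ ℚ.≤_) (ℚ-solve 4 (λ L e t x → (L :- (e :- t)) :⊕ (L :- (t :- x)) :≈ L :⊕ L :- (e :- x)) refl L e t x)
        (0≤+ (upper te) (upper k)))
      (subst (0ℚ ℚ.≤_) (ℚ-solve 4 (λ L e t x → (L :⊕ (e :- t)) :⊕ (L :⊕ (t :- x)) :≈ L :⊕ L :⊕ (e :- x)) refl L e t x)
        (0≤+ (lower te) (lower k)))
    T≥0 : ∀ {x y} → Close L x v → Close L y v → Close L t x → Close L t y →
      0ℚ ℚ.≤ (L ℚ.+ L ℚ.- (t ℚ.- v) ℚ.- (x ℚ.- y)) ℚ.* (L ℚ.+ L ℚ.- (t ℚ.- v) ℚ.+ (x ℚ.- y))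
    T≥0 {x} {y} vx vy xt yt = 0≤*
      (subst (0ℚ ℚ.≤_) (ℚ-solve 5 (λ L v x y t → (L :- (x :- v)) :⊕ (L :- (t :- y)) :≈ L :⊕ L :- (t :- v) :- (x :- y)) refl L v x y t)
        (0≤+ (upper vx) (upper yt)))
      (subst (0ℚ ℚ.≤_) (ℚ-solve 5 (λ L v x y t → (L :- (y :- v)) :⊕ (L :- (t :- x)) :≈ L :⊕ L :- (t :- v) :⊕ (x :- y)) refl L v x y t)
        (0≤+ (upper vy) (upper xt)))
    2L-g≥0 : 0ℚ ℚ.≤ L ℚ.+ L ℚ.- (t ℚ.- v)
    2L-g≥0 = subst (0ℚ ℚ.≤_) (ℚ-solve 4 (λ L v x t → (L :- (x :- v)) :⊕ (L :- (t :- x)) :≈ L :⊕ L :- (t :- v)) refl L v a t)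
      (0≤+ (upper va) (upper at))
    slack≥0 : 0ℚ ℚ.≤ slack v a b c t e L
    slack≥0 = 0≤+ (0≤+ (0≤+ (0≤+ (0≤+
      (0≤+ (0≤+ (P≥0 va at) (P≥0 vb bt)) (P≥0 vc ct))
      (0≤+ (0≤+ (R≥0 at) (R≥0 bt)) (R≥0 ct)))
      (0≤+ (0≤+ (T≥0 va vb at bt) (T≥0 vb vc bt ct)) (T≥0 vc va ct at)))
      (0≤* (upper te) (0≤+ (0≤+ g≥0 g≥0) (lower te))))
      (0≤* (upper te) (lower te)))
      (0≤* {+ 8 ℚ./ 1} (ℚₚ.nonNegative⁻¹ _) (0≤* g≥0 2L-g≥0))

  var₆≤ : ∀ v a b c t e →
    Close L a v → Close L b v → Close L c v → Close L t a → Close L t b → Close L t c → Close L e t →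
    var₆ v a b c t e ℚ.≤ + 8 ℚ./ 9 ℚ.* (L ℚ.* L)
  var₆≤ v a b c t e va vb vc at bt ct te with ℚₚ.≤-total v t
  ... | inj₁ v≤t = var₆≤-pos v a b c t e va vb vc at bt ct te v≤t
  ... | inj₂ t≤v = subst (ℚ._≤ _) (var₆-neg v a b c t e)
    (var₆≤-pos (ℚ.- v) (ℚ.- a) (ℚ.- b) (ℚ.- c) (ℚ.- t) (ℚ.- e)
      (Close-neg va) (Close-neg vb) (Close-neg vc) (Close-neg at) (Close-neg bt) (Close-neg ct) (Close-neg te)
      (ℚₚ.neg-antimono-≤ t≤v))

-- The function X and its optimality over the reals

X : Vertex G → ℝ
X u = -ᴿ fromℕ (level u)

∣-a+b∣≤∣a-b∣ : ∀ a b → ℚ.∣ ℚ.- (+ a ℚ./ 1) ℚ.- ℚ.- (+ b ℚ./ 1) ∣ ℚ.≤ + ∣ a - b ∣ ℚ./ 1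
∣-a+b∣≤∣a-b∣ a b = [ ordered a b , (λ b≤a → subst₂ (λ p k → p ℚ.≤ + k ℚ./ 1)
                       (∣∣-swap (+ b ℚ./ 1) (+ a ℚ./ 1)) (∣-∣-comm b a) (ordered b a b≤a)) ]′ (≤-total a b)
  where
  ∣∣-swap : ∀ p q → ℚ.∣ ℚ.- p ℚ.- ℚ.- q ∣ ≡ ℚ.∣ ℚ.- q ℚ.- ℚ.- p ∣
  ∣∣-swap p q = trans (sym (ℚₚ.∣-p∣≡∣p∣ (ℚ.- p ℚ.- ℚ.- q)))
    (cong ℚ.∣_∣ (ℚ-solve 2 (λ p q → :- (:- p :- :- q) :≈ :- q :- :- p) refl p q))
  ordered : ∀ a b → a ≤ b → ℚ.∣ ℚ.- (+ a ℚ./ 1) ℚ.- ℚ.- (+ b ℚ./ 1) ∣ ℚ.≤ + ∣ a - b ∣ ℚ./ 1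
  ordered a b a≤b = ℚₚ.≤-reflexive (begin
    ℚ.∣ ℚ.- A ℚ.- ℚ.- (+ b ℚ./ 1) ∣     ≡⟨ cong (λ z → ℚ.∣ ℚ.- A ℚ.- ℚ.- z ∣) b≡a+c ⟩
    ℚ.∣ ℚ.- A ℚ.- ℚ.- (A ℚ.+ C) ∣       ≡⟨ cong ℚ.∣_∣ (ℚ-solve 2 (λ a c → :- a :- :- (a :⊕ c) :≈ c) refl A C) ⟩
    ℚ.∣ C ∣                             ≡⟨ ℚₚ.0≤p⇒∣p∣≡p (/-mono-≤ 0 ∣ a - b ∣ 1 1 z≤n) ⟩
    C                                   ∎)
    where
    open ≡-Reasoning
    A = + a ℚ./ 1
    C = + ∣ a - b ∣ ℚ./ 1
    b≡a+c : + b ℚ./ 1 ≡ A ℚ.+ C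
    b≡a+c = trans (cong (λ x → + x ℚ./ 1) (sym (trans (cong (λ z → a + z) (m≤n⇒∣m-n∣≡n∸m a≤b)) (m+[n∸m]≡n a≤b))))
                  (/1-+ a ∣ a - b ∣)

X-lipschitz : IsLipschitz G X
X-lipschitz u v ε ε>0 = 0 , λ _ _ → ≤+ε (ℚₚ.≤-trans (∣-a+b∣≤∣a-b∣ (level u) (level v))
  (/-mono-≤ ∣ level u - level v ∣ (dist G u v) 1 1 (*-monoˡ-≤ 1 (level-dist u v)))) ε>0

Eventually : (ℕ → Set) → Set
Eventually P = ∃[ N ] ∀ n → N ≤ n → P n

infixr 4 _and_

_and_ : ∀ {P Q} → Eventually P → Eventually Q → Eventually λ n → P n × Q n
(M , p) and (N , q) = M ⊔ N , λ n h → p n (m⊔n≤o⇒m≤o M N h) , q n (m⊔n≤o⇒n≤o M N h)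

-- The terms of the Cauchy sequences obey the Lipschitz bound only up to δ; hence the general
-- constant L in the variance bound.
lipschitz-close : ∀ Y → IsLipschitz G Y → ∀ u v → Adj u v → ∀ δ → 0ℚ ℚ.< δ →
  Eventually λ n → Close (1ℚ ℚ.+ δ) (seq (Y u) n) (seq (Y v) n)
lipschitz-close Y lip u v e δ δ>0 with lip u v δ δ>0
... | N , h = N , λ n N≤n → close (ℚₚ.≤-trans (h n N≤n)
  (ℚₚ.+-monoˡ-≤ δ (/-mono-≤ (dist G u v) 1 1 1 (*-monoˡ-≤ 1 (dist-adj u v e)))))

min-1 : ∀ ε → 0ℚ ℚ.< ε → ∃[ η ] 0ℚ ℚ.< η × η ℚ.≤ 1ℚ × η ℚ.≤ ε
min-1 ε ε>0 with ℚₚ.≤-total ε 1ℚ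
... | inj₁ ε≤1 = ε , ε>0 , ε≤1 , ℚₚ.≤-refl
... | inj₂ 1≤ε = 1ℚ , ℚₚ.positive⁻¹ 1ℚ , ℚₚ.≤-refl , 1≤ε

-- The loss is 16/27 η + 8/81 η², below η once η ≤ 1; this fixes the choice δ = η / 3.
scaled-bound : ∀ η → 0ℚ ℚ.≤ η → η ℚ.≤ 1ℚ →
  let L = 1ℚ ℚ.+ + 1 ℚ./ 3 ℚ.* η in + 8 ℚ./ 9 ℚ.* (L ℚ.* L) ℚ.≤ + 8 ℚ./ 9 ℚ.+ η
scaled-bound η η≥0 η≤1 = subst₂ ℚ._≤_ (ℚₚ.+-identityʳ _)
  (ℚ-solve 1 (λ η → let L = ℚ-con 1ℚ :⊕ ℚ-con (+ 1 ℚ./ 3) :⊗ η in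
      ℚ-con (+ 8 ℚ./ 9) :⊗ (L :⊗ L) :⊕ (ℚ-con (+ 25 ℚ./ 81) :⊗ η :⊕ ℚ-con (+ 8 ℚ./ 81) :⊗ (η :⊗ (ℚ-con 1ℚ :- η)))
        :≈ ℚ-con (+ 8 ℚ./ 9) :⊕ η) refl η)
  (ℚₚ.+-monoʳ-≤ (+ 8 ℚ./ 9 ℚ.* (L ℚ.* L)) {0ℚ}
    (0≤+ (0≤* {+ 25 ℚ./ 81} (ℚₚ.nonNegative⁻¹ _) η≥0)
         (0≤* {+ 8 ℚ./ 81} (ℚₚ.nonNegative⁻¹ _) (0≤* η≥0 (p≤q⇒0≤q-p η≤1)))))
  where L = 1ℚ ℚ.+ + 1 ℚ./ 3 ℚ.* η

X-optimal : IsVarianceOptimal G X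
X-optimal = X-lipschitz , λ Y lip ε ε>0 →
  let η , η>0 , η≤1 , η≤ε = min-1 ε ε>0
      δ = + 1 ℚ./ 3 ℚ.* η
      δ>0 = subst (ℚ._< δ) (ℚₚ.*-zeroʳ (+ 1 ℚ./ 3)) (ℚₚ.*-monoʳ-<-pos (+ 1 ℚ./ 3) η>0)
      edge = λ u v (e : Adj u v) → lipschitz-close Y lip u v e δ δ>0
      N , h = edge 1F 0F refl and edge 2F 0F refl and edge 3F 0F refl
          and edge 4F 1F refl and edge 4F 2F refl and edge 4F 3F refl and edge 5F 4F refl
  in N , λ n N≤n →
    let va , vb , vc , at , bt , ct , te = h n N≤n
    in ℚₚ.≤-trans
         (var₆≤ (1ℚ ℚ.+ δ) (seq (Y 0F) n) (seq (Y 1F) n) (seq (Y 2F) n) (seq (Y 3F) n) (seq (Y 4F) n) (seq (Y 5F) n)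
            va vb vc at bt ct te)
         -- Every term of `Var G X` evaluates to 8/9.
         (ℚₚ.≤-trans (scaled-bound η (ℚₚ.<⇒≤ η>0) η≤1) (ℚₚ.+-monoʳ-≤ (+ 8 ℚ./ 9) η≤ε))

-- The sublevel sets and their rivals

-- A zero threshold makes the sublevel set everything, which takes care of AtLeastHalf for small n.
threshold : ℕ → ℕ
threshold n = if does (14 ≤? root₄ n) then suc (radius n) else 0

threshold-large : ∀ n → 14 ≤ root₄ n → threshold n ≡ suc (radius n)
threshold-large n h = cong (if_then suc (radius n) else 0) (dec-true (14 ≤? root₄ n) h)

threshold-cases : ∀ n → threshold n ≡ 0 ⊎ (14 ≤ root₄ n × threshold n ≡ suc (radius n))
threshold-cases n with 14 ≤? root₄ n
... | yes h = inj₂ (h , threshold-large n h)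
... | no ¬h = inj₁ (cong (if_then suc (radius n) else 0) (dec-false (14 ≤? root₄ n) ¬h))

cutoff : ℕ → ℝ
cutoff n = -ᴿ fromℕ (threshold n)

-- All values of `X` are constant sequences, so membership in the sublevel set reduces to a
-- decidable comparison in ℕ.
seq-sum : ∀ {n} (s : Vertexⁿ G n) i → seq (sumᴿ (Vec.map X s)) i ≡ ℚ.- (+ weight level s ℚ./ 1)
seq-sum []      i = refl
seq-sum (x ∷ s) i = begin
  ℚ.- (+ level x ℚ./ 1) ℚ.+ seq (sumᴿ (Vec.map X s)) i       ≡⟨ cong (ℚ.- (+ level x ℚ./ 1) ℚ.+_) (seq-sum s i) ⟩
  ℚ.- (+ level x ℚ./ 1) ℚ.+ ℚ.- (+ weight level s ℚ./ 1)     ≡⟨ ℚₚ.neg-distrib-+ (+ level x ℚ./ 1) _ ⟨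
  ℚ.- (+ level x ℚ./ 1 ℚ.+ + weight level s ℚ./ 1)           ≡⟨ cong ℚ.-_ (/1-+ (level x) (weight level s)) ⟨
  ℚ.- (+ (level x + weight level s) ℚ./ 1)                   ∎
  where open ≡-Reasoning

sum-X-≤ : ∀ k {n} (s : Vertexⁿ G n) → k ≤ weight level s → sumᴿ (Vec.map X s) ≤ᴿ -ᴿ fromℕ k
sum-X-≤ k s h ε ε>0 = 0 , λ i _ → ≤+ε {seq (sumᴿ (Vec.map X s)) i} {ℚ.- (+ k ℚ./ 1)}
  (subst (ℚ._≤ ℚ.- (+ k ℚ./ 1)) (sym (seq-sum s i))
    (ℚₚ.neg-antimono-≤ {+ k ℚ./ 1} {+ weight level s ℚ./ 1}
      (/-mono-≤ k (weight level s) 1 1 (*-monoˡ-≤ 1 h)))) ε>0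

≤ᴿ-neg-constant : ∀ x y p q → (∀ i → seq x i ≡ ℚ.- p) → (∀ i → seq y i ≡ ℚ.- q) → x ≤ᴿ y → q ℚ.≤ p
≤ᴿ-neg-constant x y p q x≡ y≡ x≤y = subst₂ ℚ._≤_ (neg-involutive q) (neg-involutive p)
  (ℚₚ.neg-antimono-≤ (≤-archimedean (ℚ.- p) (ℚ.- q) approx))
  where
  neg-involutive : ∀ p → ℚ.- ℚ.- p ≡ p
  neg-involutive = ⁻¹-involutive ℚₚ.+-0-group
  approx : ∀ ε → 0ℚ ℚ.< ε → ℚ.- p ℚ.≤ ℚ.- q ℚ.+ ε
  approx ε ε>0 = let N , h = x≤y ε ε>0 in
    subst₂ (λ a b → a ℚ.≤ b ℚ.+ ε) (x≡ N) (y≡ N) (h N ≤-refl)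

sum-X-≤⁻ : ∀ k {n} (s : Vertexⁿ G n) → sumᴿ (Vec.map X s) ≤ᴿ -ᴿ fromℕ k → k ≤ weight level s
sum-X-≤⁻ k s h = /1-cancel-≤ k (weight level s)
  (≤ᴿ-neg-constant (sumᴿ (Vec.map X s)) (-ᴿ fromℕ k) (+ weight level s ℚ./ 1) (+ k ℚ./ 1) (seq-sum s) (λ _ → refl) h)

Low : ∀ n → Pred (Vertexⁿ G n) 0ℓ
Low n = Sublevel G X n (cutoff n)

low-intro : ∀ n s → threshold n ≤ weight level s → Low n s
low-intro n s = sum-X-≤ (threshold n) s

low-elim : ∀ n s → Low n s → threshold n ≤ weight level s
low-elim n s = sum-X-≤⁻ (threshold n) s

low? : ∀ n → Decidable (Low n)
low? n s = map′ (low-intro n s) (low-elim n s) (threshold n ≤? weight level s)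

ball? : ∀ {n} {S : Pred (Vertexⁿ G n) 0ℓ} → Decidable S → ∀ d → Decidable (Ball G d S)
ball? {n} S? d u = map′
  (λ h → let v , _ , p = find h in v , p)
  (λ (v , p) → lose (words-complete v) p)
  (Any.any? (λ v → S? v ×-dec distⁿ G u v ≤? d) (words 6 n))

-- From `root₄ n` ≥ c + 1 and d · `root₄ n` ≤ n follows (c + 1) d ≤ n, and d ≥ 1 gives strictness.
c*radius<n : ∀ c n → c < 14 → 14 ≤ root₄ n → c * radius n < n
c*radius<n c n c<14 h = begin
  suc (c * radius n)        ≤⟨ +-monoˡ-≤ (c * radius n) (≤-trans (s≤s z≤n) (≤-trans h (root₄≤radius n))) ⟩
  suc c * radius n          ≡⟨ *-comm (suc c) (radius n) ⟩
  radius n * suc c          ≤⟨ *-monoʳ-≤ (radius n) (≤-trans c<14 h) ⟩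
  radius n * root₄ n        ≤⟨ radius*root₄≤n n ⟩
  n                         ∎
  where open ≤-Reasoning

2*4^d≤3^n : ∀ d n → suc (2 * d) ≤ n → 2 * 4 ^ d ≤ 3 ^ n
2*4^d≤3^n d n h = begin
  2 * 4 ^ d            ≤⟨ *-mono-≤ (n≤1+n 2) (^-monoˡ-≤ d (m≤m+n 4 5)) ⟩
  3 * 9 ^ d            ≡⟨ cong (3 *_) (^-*-assoc 3 2 d) ⟩
  3 ^ suc (2 * d)      ≤⟨ ^-monoʳ-≤ 3 h ⟩
  3 ^ n                ∎
  where open ≤-Reasoning

2*#level≤6^n : ∀ n d → suc (2 * d) ≤ n → 2 * #≤ level n 0 d ≤ 6 ^ n
2*#level≤6^n n d h = begin
  2 * #≤ level n 0 d           ≡⟨ cong (2 *_) (*-identityˡ (#≤ level n 0 d)) ⟨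
  2 * (1 * #≤ level n 0 d)     ≤⟨ *-monoʳ-≤ 2 (#level-upper n 0 d) ⟩
  2 * (4 ^ d * 2 ^ n)          ≡⟨ solve 2 (λ p q → con 2 :* (p :* q) := q :* (con 2 :* p)) refl (4 ^ d) (2 ^ n) ⟩
  2 ^ n * (2 * 4 ^ d)          ≤⟨ *-monoʳ-≤ (2 ^ n) (2*4^d≤3^n d n h) ⟩
  2 ^ n * 3 ^ n                ≡⟨ 6^d≡2^d*3^d n ⟨
  6 ^ n                        ∎
  where open ≤-Reasoning

¬low⇒weight≤radius : ∀ n → threshold n ≡ suc (radius n) → ∁ (Low n) ⊆ λ s → 0 + weight level s ≤ radius n
¬low⇒weight≤radius n eq {s} ¬low =
  ≮⇒≥ λ h → ¬low (low-intro n s (subst (_≤ weight level s) (sym eq) h))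

weight≤radius⇒¬low : ∀ n → threshold n ≡ suc (radius n) → (λ s → 0 + weight level s ≤ radius n) ⊆ ∁ (Low n)
weight≤radius⇒¬low n eq {s} h low = <⇒≱ (subst (_≤ weight level s) eq (low-elim n s low)) h

∁low≤low : ∀ n → card (∁? (low? n)) ≤ card (low? n)
∁low≤low n = [ trivial , proper ]′ (threshold-cases n)
  where
  c = card (∁? (low? n))
  trivial : threshold n ≡ 0 → c ≤ card (low? n)
  trivial eq = card-mono (∁? (low? n)) (low? n)
    λ {s} ¬low → contradiction (low-intro n s (subst (_≤ weight level s) (sym eq) z≤n)) ¬low
  proper : 14 ≤ root₄ n × threshold n ≡ suc (radius n) → c ≤ card (low? n)
  proper (h , eq) = +-cancelʳ-≤ c c (card (low? n)) (begin
    c + c                                 ≡⟨ cong (λ z → c + z) (+-identityʳ c) ⟨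
    2 * c                                 ≤⟨ *-monoʳ-≤ 2 (card-mono (∁? (low? n)) (λ s → 0 + weight level s ≤? radius n) (λ {s} → ¬low⇒weight≤radius n eq {s})) ⟩
    2 * #≤ level n 0 (radius n)           ≤⟨ 2*#level≤6^n n (radius n) (c*radius<n 2 n (m≤m+n 3 11) h) ⟩
    6 ^ n                                 ≡⟨ length-words 6 n ⟨
    length (words 6 n)                    ≡⟨ card-∁ (low? n) ⟨
    card (low? n) + c                     ∎)
    where open ≤-Reasoning

low-half : ∀ n → AtLeastHalf (Low n)
low-half n = card all? , card (low? n) , hasCard all? , hasCard (low? n) , (begin
  card all?                              ≤⟨ length-filter all? (words 6 n) ⟩
  length (words 6 n)                     ≡⟨ card-∁ (low? n) ⟨
  card (low? n) + card (∁? (low? n))     ≤⟨ +-monoʳ-≤ (card (low? n)) (∁low≤low n) ⟩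
  card (low? n) + card (low? n)          ≡⟨ cong (λ z → card (low? n) + z) (+-identityʳ _) ⟨
  2 * card (low? n)                      ∎)
  where
  open ≤-Reasoning
  all? : Decidable {A = Vertexⁿ G n} U
  all? _ = yes _

-- The complement of the ball around {0, …, 5} × {5ᵐ}.
Rival : ∀ m → Pred (Vertexⁿ G (suc m)) 0ℓ
Rival m s = radius (suc m) < weight depth (Vec.tail s)

rival? : ∀ m → Decidable (Rival m)
rival? m s = radius (suc m) <? weight depth (Vec.tail s)

low≤rival : ∀ m → 14 ≤ root₄ (suc m) → Low (suc m) ≤ᶜ Rival m
low≤rival m h = card (low? (suc m)) , card (rival? m) , hasCard (low? (suc m)) , hasCard (rival? m) ,
  card-∁-anti-≤ (rival? m) (low? (suc m)) (begin
    card (∁? (rival? m))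
      ≤⟨ card-mono (∁? (rival? m)) (λ s → 0 + weight depth (Vec.tail s) ≤? d) ≮⇒≥ ⟩
    card (λ (s : Vertexⁿ G (suc m)) → 0 + weight depth (Vec.tail s) ≤? d)
      ≡⟨ card-∷ {m} (λ s → 0 + weight depth s ≤? d) ⟩
    6 * #≤ depth m 0 d
      -- The strict bound 3d < m + 1 gives 3d ≤ m, which pays for the coordinate left free in the
      -- rival.
      ≤⟨ 6*#depth≤#level m d (≤-trans h (root₄≤radius (suc m))) (s≤s⁻¹ (c*radius<n 3 (suc m) (m≤m+n 4 10) h)) ⟩
    #≤ level (suc m) 0 d
      ≤⟨ card-mono (λ s → 0 + weight level s ≤? d) (∁? (low? (suc m))) (λ {s} → weight≤radius⇒¬low (suc m) (threshold-large (suc m) h) {s}) ⟩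
    card (∁? (low? (suc m))) ∎)
  where
  open ≤-Reasoning
  d = radius (suc m)

ball-rival<ball-low : ∀ m → 14 ≤ root₄ (suc m) →
  Ball G (radius (suc m)) (Rival m) <ᶜ Ball G (radius (suc m)) (Low (suc m))
ball-rival<ball-low m h = card ballR? , card ballL? , hasCard ballR? , hasCard ballL? ,
  card-∁-anti-< ballL? ballR? (begin-strict
    card (∁? ballL?)               ≤⟨ card-mono (∁? ballL?) (λ s → 0 + weight level s ≤? 0) (λ {u} → only-origin {u}) ⟩
    #≤ level (suc m) 0 0           ≡⟨ #level-zero (suc m) ⟩
    1                              <⟨ s≤s (s≤s z≤n) ⟩
    6                              ≤⟨ *-monoʳ-≤ 6 (1≤#depth m) ⟩
    6 * #≤ depth m 0 0             ≡⟨ card-∷ {m} (λ s → 0 + weight depth s ≤? 0) ⟨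
    card (λ (s : Vertexⁿ G (suc m)) → 0 + weight depth (Vec.tail s) ≤? 0)
                                   ≤⟨ card-mono (λ (s : Vertexⁿ G (suc m)) → 0 + weight depth (Vec.tail s) ≤? 0) (∁? ballR?) (λ {u} → far-from-rival {u}) ⟩
    card (∁? ballR?)               ∎)
  where
  open ≤-Reasoning
  d = radius (suc m)
  ballL? = ball? (low? (suc m)) d
  ballR? = ball? (rival? m) d
  d<n : d < suc m
  d<n = subst (_< suc m) (*-identityˡ d) (c*radius<n 1 (suc m) (m≤m+n 2 12) h)
  only-origin : ∁ (Ball G d (Low (suc m))) ⊆ λ u → 0 + weight level u ≤ 0
  only-origin {u} ¬ball = ≮⇒≥ λ u>0 → let a , near , high = climb₊ d u d<n u>0 in
    ¬ball (a , low-intro (suc m) a (subst (_≤ weight level a) (sym (threshold-large (suc m) h)) high) , near)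
  -- A tail of depth 0 is 5ᵐ, and every rival point has a tail of depth above d, hence lies farther
  -- than d away whatever the heads are.
  far-from-rival : (λ u → 0 + weight depth (Vec.tail u) ≤ 0) ⊆ ∁ (Ball G d (Rival m))
  far-from-rival {x ∷ u} u≤0 (y ∷ v , far , near) =
    <⇒≱ far (≤-trans (≤-trans (weight-depth≤distⁿ u v u≤0) (m≤n+m _ (dist G x y))) near)

theorem2p19 : Σ[ G ∈ ConnectedGraph ] Σ[ X ∈ (Vertex G → ℝ) ]
    Σ[ d ∈ (ℕ → ℕ) ] Σ[ r ∈ (ℕ → ℝ) ]
    IsVarianceOptimal G X
    × (∀ n → 1 ≤ n → 1 ≤ d n)
    × d /√n→∞
    × d /n→0
    × (∀ n → 1 ≤ n → AtLeastHalf (Sublevel G X n (r n)))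
    × (∀ N → ∃[ n ] N ≤ n × 1 ≤ n ×
    (Σ[ S′ ∈ Pred (Vertexⁿ G n) 0ℓ ]
    Sublevel G X n (r n) ≤ᶜ S′
    × Ball G (d n) S′ <ᶜ Ball G (d n) (Sublevel G X n (r n))))
theorem2p19 = G , X , radius , cutoff , X-optimal , 1≤radius , radius-superroot , radius-sublinear ,
  (λ n _ → low-half n) , (λ N → rival-above N (14 + N) (m≤m+n 14 N) (m≤n+m N 14))
  where
  rival : ∀ n → 14 ≤ root₄ n → 1 ≤ n → Σ[ S′ ∈ Pred (Vertexⁿ G n) 0ℓ ]
    Low n ≤ᶜ S′ × Ball G (radius n) S′ <ᶜ Ball G (radius n) (Low n)
  rival (suc m) h _ = Rival m , low≤rival m h , ball-rival<ball-low m h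
  rival-above : ∀ N k → 14 ≤ k → N ≤ k → ∃[ n ] N ≤ n × 1 ≤ n ×
    (Σ[ S′ ∈ Pred (Vertexⁿ G n) 0ℓ ] Low n ≤ᶜ S′ × Ball G (radius n) S′ <ᶜ Ball G (radius n) (Low n))
  rival-above N zero      ()
  rival-above N k@(suc _) 14≤k N≤k =
    n , ≤-trans N≤k k≤n , 1≤n , rival n (≤-trans 14≤k (root₄-≥ k ≤-refl)) 1≤n
    where
    -- A fourth power, so that `root₄ n` ≥ k; with k = 14 + N this is at least 14, while n ≥ N.
    n = (k * k) * (k * k)
    k≤n : k ≤ n
    k≤n = ≤-trans (m≤m*n k k) (m≤m*n (k * k) (k * k))
    1≤n : 1 ≤ n
    1≤n = ≤-trans (s≤s z≤n) k≤n
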